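{- Let $f:\{0,1\}^n\to\{0,1\}$ be a Boolean function with $s_1(f)=2$. Then $$C_0(f)\le\frac{37+\sqrt5}{22}\,s_0(f).$$
   Context: For $x\in\{0,1\}^n$, $x^i$ denotes $x$ with the $i$-th bit flipped. Sensitivity: $s(f,x)=|\{i\in[n]: f(x)\ne f(x^i)\}|$ and, for $b\in\{0,1\}$, $s_b(f)=\max_{x\in f^{ -1}(b)}s(f,x)$. A partial assignment is a map $p:[n]\to\{0,1,\ast\}$; its support is $\{i:p(i)\ne\ast\}$ and its co-dimension is the size of the support. An input $x$ is consistent with $p$ if $x_i=p(i)$ for all $i$ in the support. $p$ is a $b$-certificate if $f(x)=b$ for every $x$ consistent with $p$. $C(f,x)$ is the minimum co-dimension of an $f(x)$-certificate with which $x$ is consistent, and $C_b(f)=\max_{x\in f^{ -1}(b)}C(f,x)$. -}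

module Defs where

open import Data.Bool.Base using (Bool; true; false; not)
open import Data.Bool.Properties using (_≟_)
open import Data.Fin.Base using (Fin)
import Data.Fin.Properties as Fin
open import Data.Integer.Base using (+_)
open import Data.List.Base using (List; []; _∷_; map; filter; length; allFin; cartesianProductWith)
open import Data.List.Extrema.Nat using (max; min)
open import Data.List.Membership.Propositional using (_∈_)
open import Data.List.Membership.Propositional.Properties using (∈-cartesianProductWith⁺)
import Data.List.Relation.Unary.All as List
open import Data.List.Relation.Unary.Any using (here; there)
open import Data.Maybe.Base using (Maybe; just; nothing; is-just)
import Data.Maybe.Relation.Unary.All as Maybe
open import Data.Nat.Base as ℕ using (ℕ; zero; suc)
open import Data.Rational.Base as ℚ using (ℚ; 0ℚ; 1ℚ)
open import Data.Vec.Base as Vec using (Vec; lookup; _[_]%=_; countᵇ)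
open import Relation.Binary.PropositionalEquality.Core using (_≡_; refl)
open import Relation.Nullary.Decidable using (Dec; map′; ¬?; _→-dec_; _×-dec_)
open import Relation.Unary using (Decidable)
open import Data.Product.Base using (_×_)

Input : ℕ → Set
Input n = Vec Bool n

BoolFun : ℕ → Set
BoolFun n = Input n → Bool

-- nothing stands for ∗.
PartialAssignment : ℕ → Set
PartialAssignment n = Vec (Maybe Bool) n

vectors : ∀ {A : Set} → List A → ∀ n → List (Vec A n)
vectors xs zero    = Vec.[] ∷ []
vectors xs (suc n) = cartesianProductWith Vec._∷_ xs (vectors xs n)

∈-vectors : ∀ {A : Set} {xs : List A} → (∀ x → x ∈ xs) →
            ∀ {n} (v : Vec A n) → v ∈ vectors xs n
∈-vectors all Vec.[]       = here refl
∈-vectors all (x Vec.∷ v) = ∈-cartesianProductWith⁺ Vec._∷_ (all x) (∈-vectors all v)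

inputs : ∀ n → List (Input n)
inputs = vectors (false ∷ true ∷ [])

∈-inputs : ∀ {n} (x : Input n) → x ∈ inputs n
∈-inputs = ∈-vectors λ where
  false → here refl
  true  → there (here refl)

partialAssignments : ∀ n → List (PartialAssignment n)
partialAssignments = vectors (nothing ∷ just false ∷ just true ∷ [])

∈-partialAssignments : ∀ {n} (p : PartialAssignment n) → p ∈ partialAssignments n
∈-partialAssignments = ∈-vectors λ where
  nothing      → here refl
  (just false) → there (here refl)
  (just true)  → there (there (here refl))

-- The maximum of g over f⁻¹(b); it is 0 when f⁻¹(b) is empty.
maxOver : ∀ {n} → Bool → BoolFun n → (Input n → ℕ) → ℕ
maxOver {n} b f g = max 0 (map g (filter (λ x → f x ≟ b) (inputs n)))

flip : ∀ {n} → Input n → Fin n → Input n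
flip x i = x [ i ]%= not

sensitivity : ∀ {n} → BoolFun n → Input n → ℕ
sensitivity {n} f x = length (filter (λ i → ¬? (f x ≟ f (flip x i))) (allFin n))

s : ∀ {n} → Bool → BoolFun n → ℕ
s b f = maxOver b f (sensitivity f)

codim : ∀ {n} → PartialAssignment n → ℕ
codim = countᵇ is-just

Consistent : ∀ {n} → Input n → PartialAssignment n → Set
Consistent x p = ∀ i → Maybe.All (lookup x i ≡_) (lookup p i)

consistent? : ∀ {n} (x : Input n) (p : PartialAssignment n) → Dec (Consistent x p)
consistent? x p = Fin.all? λ i → Maybe.dec (lookup x i ≟_) (lookup p i)

Certificate : ∀ {n} → BoolFun n → Bool → PartialAssignment n → Set
Certificate f b p = ∀ x → Consistent x p → f x ≡ b

certificate? : ∀ {n} (f : BoolFun n) b → Decidable (Certificate f b)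
certificate? f b p =
  map′ (λ all x → List.lookup all (∈-inputs x)) (λ cert → List.universal cert _)
       (List.all? (λ x → consistent? x p →-dec (f x ≟ b)) (inputs _))

CertificateAt : ∀ {n} → BoolFun n → Input n → PartialAssignment n → Set
CertificateAt f x p = Consistent x p × Certificate f (f x) p

certificateAt? : ∀ {n} (f : BoolFun n) x → Decidable (CertificateAt f x)
certificateAt? f x p = consistent? x p ×-dec certificate? f (f x) p

-- The base value n does not affect the minimum: x itself, read as a total
-- assignment, is a certificate of co-dimension n.
certificateComplexity : ∀ {n} → BoolFun n → Input n → ℕ
certificateComplexity {n} f x =
  min n (map codim (filter (certificateAt? f x) (partialAssignments n)))

C : ∀ {n} → Bool → BoolFun n → ℕ
C b f = maxOver b f (certificateComplexity f)

-- The subfield ℚ(√5) of ℝ; a +√5· b stands for the real number a + b√5.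
infix 5 _+√5·_

record ℚ[√5] : Set where
  constructor _+√5·_
  field
    rat irr : ℚ

fromℚ : ℚ → ℚ[√5]
fromℚ q = q +√5· 0ℚ

fromℕ : ℕ → ℚ[√5]
fromℕ k = fromℚ (+ k ℚ./ 1)

√5 : ℚ[√5]
√5 = 0ℚ +√5· 1ℚ

infixl 6 _+_ _-_
infixl 7 _*_ _/_

_+_ _-_ _*_ : ℚ[√5] → ℚ[√5] → ℚ[√5]
(a +√5· b) + (c +√5· d) = (a ℚ.+ c) +√5· (b ℚ.+ d)
(a +√5· b) - (c +√5· d) = (a ℚ.- c) +√5· (b ℚ.- d)
(a +√5· b) * (c +√5· d) =
  (a ℚ.* c ℚ.+ (+ 5 ℚ./ 1) ℚ.* (b ℚ.* d)) +√5· (a ℚ.* d ℚ.+ b ℚ.* c)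

_/_ : ℚ[√5] → (k : ℕ) .{{_ : ℕ.NonZero k}} → ℚ[√5]
x / k = x * fromℚ (+ 1 ℚ./ k)

-- The order induced from ℝ, with √5 the positive root: a + b√5 ≥ 0 iff both
-- terms are nonnegative, or one of them is and it is at least as large in
-- absolute value as the other (compared by squaring).
data NonNegative : ℚ[√5] → Set where
  both : ∀ {a b} → 0ℚ ℚ.≤ a → 0ℚ ℚ.≤ b → NonNegative (a +√5· b)
  rat≥ : ∀ {a b} → 0ℚ ℚ.≤ a → (+ 5 ℚ./ 1) ℚ.* (b ℚ.* b) ℚ.≤ a ℚ.* a → NonNegative (a +√5· b)
  irr≥ : ∀ {a b} → 0ℚ ℚ.≤ b → a ℚ.* a ℚ.≤ (+ 5 ℚ./ 1) ℚ.* (b ℚ.* b) → NonNegative (a +√5· b)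

infix 4 _≤_

_≤_ : ℚ[√5] → ℚ[√5] → Set
x ≤ y = NonNegative (y - x)

√5*√5≡5 : √5 * √5 ≡ fromℕ 5
√5*√5≡5 = refl

-- Move a 0-input of maximal certificate complexity m to the origin.  An
-- optimal certificate becomes a subcube M through 0, with m fixed coordinates,
-- on which F vanishes.  For a fixed coordinate i, the function y ↦ F (flip y i)
-- on M is not identically 0 by minimality, and its 1-points have at most one
-- neighbour in M where it is 0, since i already contributes to their
-- sensitivity.  Such a function is a literal (i is light) or heavy: it is 1
-- with probability at least 1 - ρ² for every product measure with marginals
-- at most ρ ≥ 1/2.  Averaging the sensitivity over M uniformly gives
-- 2 m + #heavy ≤ 4 s₀.
--
-- If the literal is y_j, then i and j can be exchanged: fixing j instead of i
-- yields another subcube of the same size on which F vanishes.  Give preferred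
-- values to the free coordinates: 1 if they were freed by an exchange, 0
-- otherwise.  Once no exchange is possible, only coordinates which are heavy
-- for M can yield a literal falsified by the preferred value.  With X aligned
-- literals, H heavy coordinates and K misaligned ones, averaging with
-- probability ρ for preferred values gives ρ X + (1 - ρ²) H + (1 - ρ) K ≤ s₀,
-- where X + H + K = m and 2 m + K ≤ 4 s₀.  In the worst case the best ρ is
-- (√5 - 1) / 2, whence the constant.
module Submission where

module Development where

  open import Defs hiding (_+_; _-_; _*_; _/_; _≤_)
  import Defs
  open import Data.Bool.Base using (Bool; true; false; not; _xor_; if_then_else_)
  open import Data.Bool.Properties using (not-involutive; ¬-not; xor-same; xor-identityʳ; not-distribʳ-xor) renaming (_≟_ to _≟ᵇ_)
  open import Data.Empty using (⊥; ⊥-elim)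
  open import Data.Fin.Base using (Fin; zero; suc)
  import Data.Fin.Properties as Fin
  open import Data.Integer.Base as ℤ using ()
  import Data.Integer.Properties as ℤ
  open import Data.List.Base as List using (filter; length; tabulate)
  open import Data.List.Extrema.Nat using (argmin-sel; argmax-all; min≤xs; xs≤max)
  open import Data.List.Membership.Propositional.Properties using (∈-map⁺; ∈-map⁻; ∈-filter⁺; ∈-filter⁻)
  import Data.List.Relation.Unary.All as All
  open import Data.Maybe.Base using (just; nothing)
  import Data.Maybe.Relation.Unary.All as Maybe
  open import Data.Nat.Base hiding (_/_)
  open import Data.Nat.Properties
  open import Algebra.Properties.Semiring.Sum +-*-semiring using (sum; sum-cong-≗; ∑-distrib-+; *-distribˡ-sum; *-distribʳ-sum)
  open import Data.Nat.Tactic.RingSolver using (solve-∀)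
  open import Data.Product.Base using (∃; _×_; _,_; proj₂)
  open import Data.Rational.Base as ℚ using (ℚ; 0ℚ)
  import Data.Rational.Properties as ℚ
  open import Data.Rational.Solver using (module +-*-Solver)
  open import Data.Rational.Unnormalised.Base as ℚᵘ using (mkℚᵘ; *≡*)
  import Data.Rational.Unnormalised.Properties as ℚᵘ
  open import Data.Sum.Base using (_⊎_; inj₁; inj₂)
  open import Data.Vec.Base as Vec using (Vec; []; _∷_; lookup; _[_]≔_; replicate; zipWith)
  open import Data.Vec.Properties using (lookup∘updateAt; lookup∘updateAt′; updateAt-updateAt; updateAt-id-local; updateAt-commutes; []≔-lookup; lookup-replicate; lookup-map)
  open import Function.Base using (_∘_; id)
  open import Relation.Binary.PropositionalEquality
  open import Relation.Nullary.Decidable using (yes; no; does; ¬?)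
  open import Relation.Nullary.Negation using (contradiction)
  open import Relation.Unary using (Decidable)

  -- Product measures on subcubes

  𝟙 : Bool → ℕ
  𝟙 b = if b then 1 else 0

  sum-mono : ∀ {n} {u v : Fin n → ℕ} → (∀ i → u i ≤ v i) → sum u ≤ sum v
  sum-mono {zero}  u≤v = z≤n
  sum-mono {suc n} u≤v = +-mono-≤ (u≤v zero) (sum-mono (u≤v ∘ suc))

  -- A fixed coordinate is 0.  The value carried by a free coordinate does not
  -- affect the subcube: it is the preferred value in the measures below.
  data Cell : Set where
    fixed : Cell
    free  : Bool → Cell

  Face : ℕ → Set
  Face = Vec Cell

  infix 4 _∈_

  data _∈_ : ∀ {n} → Input n → Face n → Set where
    []    : [] ∈ []
    fixed : ∀ {n y} {M : Face n} → y ∈ M → false ∷ y ∈ fixed ∷ M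
    free  : ∀ {n y} {M : Face n} {b β} → y ∈ M → b ∷ y ∈ free β ∷ M

  Free : ∀ {n} → Face n → Fin n → Set
  Free M j = ∃ λ β → lookup M j ≡ free β

  flip-∈ : ∀ {n y} {M : Face n} j → Free M j → y ∈ M → flip y j ∈ M
  flip-∈ zero    (_ , refl) (free y∈M)  = free y∈M
  flip-∈ (suc j) fr         (fixed y∈M) = fixed (flip-∈ j fr y∈M)
  flip-∈ (suc j) fr         (free y∈M)  = free (flip-∈ j fr y∈M)

  update-∈ : ∀ {n y} {M : Face n} j b → Free M j → y ∈ M → y [ j ]≔ b ∈ M
  update-∈ zero    b (_ , refl) (free y∈M)  = free y∈M
  update-∈ (suc j) b fr         (fixed y∈M) = fixed (update-∈ j b fr y∈M)
  update-∈ (suc j) b fr         (free y∈M)  = free (update-∈ j b fr y∈M)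

  -- Unnormalised expectation, with ρ = a / (a + d); the factor a + d at fixed
  -- coordinates makes the total weight (a + d) ^ n on every face.
  E : ∀ {n} → ℕ → ℕ → Face n → (Input n → ℕ) → ℕ
  E a d []           h = h []
  E a d (fixed ∷ M)  h = (a + d) * E a d M (h ∘ (false ∷_))
  E a d (free β ∷ M) h = a * E a d M (h ∘ (β ∷_)) + d * E a d M (h ∘ (not β ∷_))

  module _ (a d : ℕ) where

    E-mono : ∀ {n} (M : Face n) {h k} → (∀ {y} → y ∈ M → h y ≤ k y) → E a d M h ≤ E a d M k
    E-mono []           h≤k = h≤k []
    E-mono (fixed ∷ M)  h≤k = *-monoʳ-≤ (a + d) (E-mono M (h≤k ∘ fixed))
    E-mono (free β ∷ M) h≤k =
      +-mono-≤ (*-monoʳ-≤ a (E-mono M (h≤k ∘ free))) (*-monoʳ-≤ d (E-mono M (h≤k ∘ free)))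

    E-const : ∀ {n} (M : Face n) v → E a d M (λ _ → v) ≡ v * (a + d) ^ n
    E-const []           v = sym (*-identityʳ v)
    E-const {suc n} (fixed ∷ M)  v rewrite E-const M v = lemma (a + d) v ((a + d) ^ n)
      where lemma : ∀ c v N → c * (v * N) ≡ v * (c * N)
            lemma = solve-∀
    E-const {suc n} (free β ∷ M) v rewrite E-const M v = lemma a d v ((a + d) ^ n)
      where lemma : ∀ a d v N → a * (v * N) + d * (v * N) ≡ v * ((a + d) * N)
            lemma = solve-∀

    E-+ : ∀ {n} (M : Face n) h k → E a d M (λ y → h y + k y) ≡ E a d M h + E a d M k
    E-+ []           h k = refl
    E-+ (fixed ∷ M)  h k rewrite E-+ M (h ∘ (false ∷_)) (k ∘ (false ∷_)) = *-distribˡ-+ (a + d) _ _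
    E-+ (free β ∷ M) h k
      rewrite E-+ M (h ∘ (β ∷_)) (k ∘ (β ∷_)) | E-+ M (h ∘ (not β ∷_)) (k ∘ (not β ∷_)) =
      lemma a d (E a d M (h ∘ (β ∷_))) (E a d M (k ∘ (β ∷_)))
                (E a d M (h ∘ (not β ∷_))) (E a d M (k ∘ (not β ∷_)))
      where lemma : ∀ a d p q r t → a * (p + q) + d * (r + t) ≡ a * p + d * r + (a * q + d * t)
            lemma = solve-∀

    E-sum : ∀ {n k} (M : Face n) (h : Fin k → Input n → ℕ) →
            E a d M (λ y → sum (λ i → h i y)) ≡ sum (λ i → E a d M (h i))
    E-sum {k = zero}  M h = E-const M 0
    E-sum {k = suc k} M h = trans (E-+ M (h zero) _) (cong (E a d M (h zero) +_) (E-sum M (h ∘ suc)))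

    -- Only the coordinate `j` matters: it takes its preferred value `β` with probability ρ, and the
    -- factor `a + d` clears the denominator.
    E-literal : ∀ {n} (M : Face n) j {β} σ → lookup M j ≡ free β →
                (a + d) * E a d M (λ y → 𝟙 (σ xor lookup y j))
                  ≡ (if σ xor β then a else d) * (a + d) ^ n
    E-literal {suc n} (free β ∷ M) zero σ refl
      rewrite E-const M (𝟙 (σ xor β)) | E-const M (𝟙 (σ xor not β)) = lemma σ β
      where
      N = (a + d) ^ n
      lemma₁ : ∀ a d N → (a + d) * (a * (1 * N) + d * (0 * N)) ≡ a * ((a + d) * N)
      lemma₁ = solve-∀
      lemma₂ : ∀ a d N → (a + d) * (a * (0 * N) + d * (1 * N)) ≡ d * ((a + d) * N)
      lemma₂ = solve-∀
      lemma : ∀ σ β → (a + d) * (a * (𝟙 (σ xor β) * N) + d * (𝟙 (σ xor not β) * N))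
                        ≡ (if σ xor β then a else d) * ((a + d) * N)
      lemma true  true  = lemma₂ a d N
      lemma true  false = lemma₁ a d N
      lemma false true  = lemma₁ a d N
      lemma false false = lemma₂ a d N
    E-literal {suc n} (fixed ∷ M) (suc j) {β} σ eq = begin
      c * (c * E a d M _)  ≡⟨ cong (c *_) (E-literal M j σ eq) ⟩
      c * (w * c ^ n)      ≡⟨ lemma c w (c ^ n) ⟩
      w * (c * c ^ n)      ∎
      where
      open ≡-Reasoning
      c = a + d
      w = if σ xor β then a else d
      lemma : ∀ c w N → c * (w * N) ≡ w * (c * N)
      lemma = solve-∀
    E-literal {suc n} (free _ ∷ M) (suc j) {β} σ eq = begin
      c * (a * e + d * e)  ≡⟨ lemma₁ a d e ⟩
      c * (c * e)          ≡⟨ cong (c *_) (E-literal M j σ eq) ⟩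
      c * (w * c ^ n)      ≡⟨ lemma₂ c w (c ^ n) ⟩
      w * (c * c ^ n)      ∎
      where
      open ≡-Reasoning
      c = a + d
      w = if σ xor β then a else d
      e = E a d M (λ y → 𝟙 (σ xor lookup y j))
      lemma₁ : ∀ a d e → (a + d) * (a * e + d * e) ≡ (a + d) * ((a + d) * e)
      lemma₁ = solve-∀
      lemma₂ : ∀ c w N → c * (w * N) ≡ w * (c * N)
      lemma₂ = solve-∀

  -- Functions with at most one 0-neighbour at each 1-point

  -- A subcube is connected by flips of its free coordinates, so a single 1 spreads to all of it.
  dichotomy : ∀ {n} (M : Face n) (h : BoolFun n) →
    (∀ {y j} → y ∈ M → Free M j → h y ≡ true → h (flip y j) ≡ true) →
    (∀ {y} → y ∈ M → h y ≡ false) ⊎ (∀ {y} → y ∈ M → h y ≡ true)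
  dichotomy [] h closed with h [] in eq
  ... | false = inj₁ λ where [] → eq
  ... | true  = inj₂ λ where [] → eq
  dichotomy (fixed ∷ M) h closed
    with dichotomy M (h ∘ (false ∷_)) (λ {_} {j} y∈M fr → closed {j = suc j} (fixed y∈M) fr)
  ... | inj₁ z = inj₁ λ where (fixed y∈M) → z y∈M
  ... | inj₂ o = inj₂ λ where (fixed y∈M) → o y∈M
  dichotomy (free β ∷ M) h closed
    with dichotomy M (h ∘ (false ∷_)) (λ {_} {j} y∈M fr → closed {j = suc j} (free y∈M) fr)
       | dichotomy M (h ∘ (true ∷_)) (λ {_} {j} y∈M fr → closed {j = suc j} (free y∈M) fr)
  ... | inj₂ o  | _       = inj₂ λ where
    (free {b = false} y∈M) → o y∈M
    (free {b = true}  y∈M) → closed {j = zero} (free y∈M) (β , refl) (o y∈M)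
  ... | _       | inj₂ o  = inj₂ λ where
    (free {b = false} y∈M) → closed {j = zero} (free y∈M) (β , refl) (o y∈M)
    (free {b = true}  y∈M) → o y∈M
  ... | inj₁ z₀ | inj₁ z₁ = inj₁ λ where
    (free {b = false} y∈M) → z₀ y∈M
    (free {b = true}  y∈M) → z₁ y∈M

  OneSensitive : ∀ {n} → Face n → BoolFun n → Set
  OneSensitive M g = ∀ {y j k} → y ∈ M → Free M j → Free M k → j ≢ k →
    g y ≡ true → g (flip y j) ≡ false → g (flip y k) ≡ true

  -- g is 1 with probability at least 1 - ρ².
  Heavy : ∀ {n} → Face n → BoolFun n → Set
  Heavy {n} M g = ∀ a d → d ≤ a →
    d * (a + (a + d)) * (a + d) ^ n ≤ (a + d) * (a + d) * E a d M (𝟙 ∘ g)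

  -- With `σ` false the literal is y_j, with `σ` true it is the negation of y_j.
  data Shape {n} (M : Face n) (g : BoolFun n) : Set where
    null    : (∀ {y} → y ∈ M → g y ≡ false) → Shape M g
    literal : ∀ j σ → Free M j → (∀ {y} → y ∈ M → g y ≡ σ xor lookup y j) → Shape M g
    heavy   : Heavy M g → Shape M g

  -- Lets a proof name the half on which something is known by an arbitrary `b`, without splitting
  -- on `b`.
  by-halves : ∀ {p} {P : Bool → Set p} b → P b → P (not b) → ∀ b′ → P b′
  by-halves false p q false = p
  by-halves false p q true  = q
  by-halves true  p q false = q
  by-halves true  p q true  = p

  xor-not : ∀ b → b xor not b ≡ true
  xor-not false = refl
  xor-not true  = refl

  if-≥ : ∀ b {a d} → d ≤ a → d ≤ (if b then a else d)
  if-≥ false d≤a = ≤-refl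
  if-≥ true  d≤a = d≤a

  E-literal-≥ : ∀ {n} (M : Face n) {g : BoolFun n} j {β} σ → lookup M j ≡ free β →
    (∀ {y} → y ∈ M → g y ≡ σ xor lookup y j) → ∀ a d →
    (if σ xor β then a else d) * (a + d) ^ n ≤ (a + d) * E a d M (𝟙 ∘ g)
  E-literal-≥ {n} M {g} j {β} σ eq lit a d = begin
    (if σ xor β then a else d) * (a + d) ^ n       ≡⟨ E-literal a d M j σ eq ⟨
    (a + d) * E a d M (λ y → 𝟙 (σ xor lookup y j)) ≤⟨ *-monoʳ-≤ (a + d) (E-mono a d M (λ y∈M → ≤-reflexive (cong 𝟙 (sym (lit y∈M))))) ⟩
    (a + d) * E a d M (𝟙 ∘ g)                      ∎
    where open ≤-Reasoning

  -- Since 1 - ρ ≤ ρ, the weight `d` is a lower bound whichever value is preferred.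
  E-literal-≥′ : ∀ {n} (M : Face n) {g : BoolFun n} j σ → Free M j →
    (∀ {y} → y ∈ M → g y ≡ σ xor lookup y j) → ∀ {a d} → d ≤ a →
    d * (a + d) ^ n ≤ (a + d) * E a d M (𝟙 ∘ g)
  E-literal-≥′ {n} M j σ (β , eq) lit {a} {d} d≤a =
    ≤-trans (*-monoˡ-≤ ((a + d) ^ n) (if-≥ (σ xor β) d≤a)) (E-literal-≥ M j σ eq lit a d)

  E-one-≥ : ∀ {n} (M : Face n) {g : BoolFun n} → (∀ {y} → y ∈ M → g y ≡ true) →
    ∀ a d → (a + d) ^ n ≤ E a d M (𝟙 ∘ g)
  E-one-≥ {n} M {g} one a d = begin
    (a + d) ^ n        ≡⟨ *-identityˡ _ ⟨
    1 * (a + d) ^ n    ≡⟨ E-const a d M 1 ⟨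
    E a d M (λ _ → 1)  ≤⟨ E-mono a d M (λ y∈M → ≤-reflexive (cong 𝟙 (sym (one y∈M)))) ⟩
    E a d M (𝟙 ∘ g)    ∎
    where open ≤-Reasoning

  heavy-fixed : ∀ {n} (M : Face n) {g} → Heavy M (g ∘ (false ∷_)) → Heavy (fixed ∷ M) g
  heavy-fixed {n} M {g} hv a d d≤a = begin
    d * (a + c) * (c * c ^ n)    ≡⟨ lemma c (d * (a + c)) (c ^ n) ⟩
    c * (d * (a + c) * c ^ n)    ≤⟨ *-monoʳ-≤ c (hv a d d≤a) ⟩
    c * (c * c * e)              ≡⟨ lemma′ c e ⟩
    c * c * (c * e)              ∎
    where
    open ≤-Reasoning
    c = a + d
    e = E a d M (𝟙 ∘ g ∘ (false ∷_))
    lemma : ∀ c t N → t * (c * N) ≡ c * (t * N)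
    lemma = solve-∀
    lemma′ : ∀ c e → c * (c * c * e) ≡ c * c * (c * e)
    lemma′ = solve-∀

  heavy-free : ∀ {n} (M : Face n) {g} β → Heavy M (g ∘ (false ∷_)) → Heavy M (g ∘ (true ∷_)) →
               Heavy (free β ∷ M) g
  heavy-free {n} M {g} β hv₀ hv₁ a d d≤a = begin
    d * (a + c) * (c * c ^ n)                            ≡⟨ lemma a d (c ^ n) ⟩
    a * (d * (a + c) * c ^ n) + d * (d * (a + c) * c ^ n) ≤⟨ +-mono-≤ (*-monoʳ-≤ a (hv β a d d≤a)) (*-monoʳ-≤ d (hv (not β) a d d≤a)) ⟩
    a * (c * c * e β) + d * (c * c * e (not β))          ≡⟨ lemma′ a d c (e β) (e (not β)) ⟩
    c * c * (a * e β + d * e (not β))                    ∎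
    where
    open ≤-Reasoning
    c = a + d
    e : Bool → ℕ
    e b = E a d M (𝟙 ∘ g ∘ (b ∷_))
    hv : ∀ b → Heavy M (g ∘ (b ∷_))
    hv false = hv₀
    hv true  = hv₁
    lemma : ∀ a d N → d * (a + (a + d)) * ((a + d) * N)
                        ≡ a * (d * (a + (a + d)) * N) + d * (d * (a + (a + d)) * N)
    lemma = solve-∀
    lemma′ : ∀ a d c e f → a * (c * c * e) + d * (c * c * f) ≡ c * c * (a * e + d * f)
    lemma′ = solve-∀

  -- `g` vanishes only where the first coordinate is `b` and the literal fails. These events are
  -- independent, and each has probability at most ρ.
  heavy-mixed : ∀ {n} (M : Face n) {g} β b j σ → Free M j →
    (∀ {y} → y ∈ M → g (b ∷ y) ≡ σ xor lookup y j) →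
    (∀ {y} → y ∈ M → g (not b ∷ y) ≡ true) → Heavy (free β ∷ M) g
  heavy-mixed {n} M {g} β b j σ fr lit one a d d≤a = by-halves {P = Goal} b same other β
    where
    open ≤-Reasoning
    c = a + d
    N = c ^ n
    e : Bool → ℕ
    e b = E a d M (𝟙 ∘ g ∘ (b ∷_))
    Goal : Bool → Set
    Goal β = d * (a + c) * (c * N) ≤ c * c * (a * e β + d * e (not β))
    lit≥ : d * N ≤ c * e b
    lit≥ = E-literal-≥′ M j σ fr lit d≤a
    one≥ : N ≤ e (not b)
    one≥ = E-one-≥ M one a d
    same : Goal b
    same = begin
      d * (a + c) * (c * N)                 ≡⟨ lemma a d N ⟩
      c * a * (d * N) + c * c * d * N       ≤⟨ +-mono-≤ (*-monoʳ-≤ (c * a) lit≥) (*-monoʳ-≤ (c * c * d) one≥) ⟩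
      c * a * (c * e b) + c * c * d * e (not b) ≡⟨ lemma′ a d c (e b) (e (not b)) ⟩
      c * c * (a * e b + d * e (not b))     ∎
      where
      lemma : ∀ a d N → d * (a + (a + d)) * ((a + d) * N) ≡ (a + d) * a * (d * N) + (a + d) * (a + d) * d * N
      lemma = solve-∀
      lemma′ : ∀ a d c e f → c * a * (c * e) + c * c * d * f ≡ c * c * (a * e + d * f)
      lemma′ = solve-∀
    other : Goal (not b)
    other rewrite not-involutive b = begin
      d * (a + c) * (c * N)                 ≡⟨ lemma a d N ⟩
      -- Here `b` has only probability 1 - ρ; the slack is `a * d ≤ a * a`.
      c * N * (d * d + a * d + a * d)       ≤⟨ *-monoʳ-≤ (c * N) (+-mono-≤ (+-monoʳ-≤ (d * d) (*-monoʳ-≤ a d≤a)) ≤-refl) ⟩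
      c * N * (d * d + a * a + a * d)       ≡⟨ lemma″ a d N ⟩
      c * c * a * N + c * d * (d * N)       ≤⟨ +-mono-≤ (*-monoʳ-≤ (c * c * a) one≥) (*-monoʳ-≤ (c * d) lit≥) ⟩
      c * c * a * e (not b) + c * d * (c * e b) ≡⟨ lemma′ a d c (e b) (e (not b)) ⟩
      c * c * (a * e (not b) + d * e b)     ∎
      where
      lemma : ∀ a d N → d * (a + (a + d)) * ((a + d) * N) ≡ (a + d) * N * (d * d + a * d + a * d)
      lemma = solve-∀
      lemma″ : ∀ a d N → (a + d) * N * (d * d + a * a + a * d) ≡ (a + d) * (a + d) * a * N + (a + d) * d * (d * N)
      lemma″ = solve-∀
      lemma′ : ∀ a d c e f → c * c * a * f + c * d * (c * e) ≡ c * c * (a * f + d * e)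
      lemma′ = solve-∀

  -- A 1-point of the other half already has a 0-neighbour across the first coordinate, so its
  -- neighbours within that half are 1, and `dichotomy` makes `g` constant there.
  half-null : ∀ {n} (M : Face n) {g} β b → OneSensitive (free β ∷ M) g →
    (∀ {y} → y ∈ M → g (b ∷ y) ≡ false) → Shape (free β ∷ M) g
  half-null M {g} β b sens z
    with dichotomy M (g ∘ (not b ∷_))
      (λ {y} {j} y∈M fr eq → sens {j = zero} {k = suc j} (free y∈M) (β , refl) fr (λ ()) eq
        (trans (cong (λ b → g (b ∷ y)) (not-involutive b)) (z y∈M)))
  ... | inj₁ z′ = null λ where
    (free {b = b′} y∈M) → by-halves {P = λ b′ → g (b′ ∷ _) ≡ false} b (z y∈M) (z′ y∈M) b′
  ... | inj₂ o  = literal zero b (β , refl) λ where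
    (free {b = b′} y∈M) → by-halves {P = λ b′ → g (b′ ∷ _) ≡ b xor b′} b
      (trans (z y∈M) (sym (xor-same b))) (trans (o y∈M) (sym (xor-not b))) b′

  -- Where the literal is true on half `b`, flipping y_j already leads to 0, so `g` is 1 across the
  -- first coordinate. Where it is false, a 1-point across has its one 0-neighbour in half `b`, so
  -- `g` is constant on that part of the other half: the value 0 extends the literal to both halves,
  -- the value 1 makes the other half constantly 1.
  half-literal : ∀ {n} (M : Face n) {g} β b → OneSensitive (free β ∷ M) g → ∀ j σ → Free M j →
    (∀ {y} → y ∈ M → g (b ∷ y) ≡ σ xor lookup y j) → Shape (free β ∷ M) g
  half-literal {n} M {g} β b sens j σ fr lit with dichotomy M h closed
    where
    h : BoolFun n
    -- Setting y_j to `σ` restricts to the points where the literal fails; the result does not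
    -- depend on y_j, which settles the direction `j` in `closed`.
    h y = g (not b ∷ y [ j ]≔ σ)
    closed : ∀ {y k} → y ∈ M → Free M k → h y ≡ true → h (flip y k) ≡ true
    closed {y} {k} y∈M fr′ eq with j Fin.≟ k
    ... | yes refl = trans (cong (λ z → g (not b ∷ z)) (updateAt-updateAt j y)) eq
    ... | no  j≢k  = trans
      (cong (λ z → g (not b ∷ z)) (updateAt-commutes j k j≢k y))
      (sens {j = zero} {k = suc k} (free y∈M′) (β , refl) fr′ (λ ()) eq (begin
        g (not (not b) ∷ y [ j ]≔ σ)    ≡⟨ cong (λ b → g (b ∷ y [ j ]≔ σ)) (not-involutive b) ⟩
        g (b ∷ y [ j ]≔ σ)              ≡⟨ lit y∈M′ ⟩
        σ xor lookup (y [ j ]≔ σ) j     ≡⟨ cong (σ xor_) (lookup∘updateAt j y) ⟩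
        σ xor σ                         ≡⟨ xor-same σ ⟩
        false                           ∎))
      where
      open ≡-Reasoning
      y∈M′ : y [ j ]≔ σ ∈ M
      y∈M′ = update-∈ j σ fr y∈M
  ... | r = result r
    where
    h = λ y → g (not b ∷ y [ j ]≔ σ)
    off : ∀ {y} → y ∈ M → lookup y j ≡ not σ → g (not b ∷ y) ≡ true
    off {y} y∈M eq = sens {j = suc j} {k = zero} (free y∈M) fr (β , refl) (λ ())
      (trans (lit y∈M) (trans (cong (σ xor_) eq) (xor-not σ)))
      (begin
        g (b ∷ flip y j)          ≡⟨ lit (flip-∈ j fr y∈M) ⟩
        σ xor lookup (flip y j) j ≡⟨ cong (σ xor_) (lookup∘updateAt j y) ⟩
        σ xor not (lookup y j)    ≡⟨ cong (λ b → σ xor not b) eq ⟩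
        σ xor not (not σ)         ≡⟨ cong (σ xor_) (not-involutive σ) ⟩
        σ xor σ                   ≡⟨ xor-same σ ⟩
        false                     ∎)
      where open ≡-Reasoning
    on : ∀ {y v} → y ∈ M → (∀ {y} → y ∈ M → h y ≡ v) → lookup y j ≡ σ → g (not b ∷ y) ≡ v
    on {y} y∈M hv eq = trans
      (cong (λ z → g (not b ∷ z)) (sym (trans (cong (y [ j ]≔_) (sym eq)) ([]≔-lookup y j)))) (hv y∈M)
    result : (∀ {y} → y ∈ M → h y ≡ false) ⊎ (∀ {y} → y ∈ M → h y ≡ true) → Shape (free β ∷ M) g
    result (inj₁ z) = literal (suc j) σ fr λ where
        (free {b = b′} y∈M) → by-halves {P = λ b′ → g (b′ ∷ _) ≡ _} b (lit y∈M) (other y∈M _ refl) b′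
      where
      other : ∀ {y} → y ∈ M → ∀ v → lookup y j ≡ v → g (not b ∷ y) ≡ σ xor lookup y j
      other {y} y∈M v eq rewrite eq = by-halves {P = λ v → lookup y j ≡ v → g (not b ∷ y) ≡ σ xor v} σ
        (λ eq → trans (on y∈M z eq) (sym (xor-same σ)))
        (λ eq → trans (off y∈M eq) (sym (xor-not σ))) v eq
    result (inj₂ o) = heavy (heavy-mixed M {g} β b j σ fr lit (λ y∈M → one y∈M _ refl))
      where
      one : ∀ {y} → y ∈ M → ∀ v → lookup y j ≡ v → g (not b ∷ y) ≡ true
      one {y} y∈M = by-halves {P = λ v → lookup y j ≡ v → g (not b ∷ y) ≡ true} σ
        (on y∈M o) (off y∈M)

  -- Induction on the dimension. A null or literal half leaves few possibilities for the other one;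
  -- two heavy halves average to a heavy function, as both satisfy the same bound.
  shape : ∀ {n} (M : Face n) (g : BoolFun n) → OneSensitive M g → Shape M g
  shape [] g sens with g [] in eq
  ... | false = null λ where [] → eq
  ... | true  = heavy λ a d d≤a → subst (λ b → d * (a + (a + d)) * 1 ≤ (a + d) * (a + d) * 𝟙 b) (sym eq)
    (*-monoˡ-≤ 1 (≤-trans (m≤m+n _ (a * a)) (≤-reflexive (lemma a d))))
    where lemma : ∀ a d → d * (a + (a + d)) + a * a ≡ (a + d) * (a + d)
          lemma = solve-∀
  shape (fixed ∷ M) g sens
    with shape M (g ∘ (false ∷_))
      (λ y∈M fr fr′ j≢k → sens (fixed y∈M) fr fr′ (j≢k ∘ Fin.suc-injective))
  ... | null z             = null λ where (fixed y∈M) → z y∈M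
  ... | literal j σ fr lit = literal (suc j) σ fr λ where (fixed y∈M) → lit y∈M
  ... | heavy hv           = heavy (heavy-fixed M {g} hv)
  shape (free β ∷ M) g sens
    with shape M (g ∘ (false ∷_)) (λ y∈M fr fr′ j≢k → sens (free y∈M) fr fr′ (j≢k ∘ Fin.suc-injective))
       | shape M (g ∘ (true ∷_)) (λ y∈M fr fr′ j≢k → sens (free y∈M) fr fr′ (j≢k ∘ Fin.suc-injective))
  ... | null z             | _                  = half-null M β false sens z
  ... | literal j σ fr lit | _                  = half-literal M β false sens j σ fr lit
  ... | heavy _            | null z             = half-null M β true sens z
  ... | heavy _            | literal j σ fr lit = half-literal M β true sens j σ fr lit
  ... | heavy hv₀          | heavy hv₁          = heavy (heavy-free M {g} β hv₀ hv₁)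

  -- Certificates as subcubes

  flip-flip : ∀ {n} (y : Input n) i → flip (flip y i) i ≡ y
  flip-flip y i = trans (updateAt-updateAt i y) (updateAt-id-local i y (not-involutive _))

  -- The number of cells with `isFalse` falls by one with each exchange, so the exchanges terminate.
  isFixed isFalse : Cell → Bool
  isFixed fixed    = true
  isFixed (free _) = false
  isFalse fixed    = false
  isFalse (free β) = not β

  count : ∀ {n} → (Cell → Bool) → Face n → ℕ
  count p M = sum (λ i → 𝟙 (p (lookup M i)))

  codimension : ∀ {n} → Face n → ℕ
  codimension = count isFixed

  count-update : ∀ {n} p (M : Face n) i {x x′} → lookup M i ≡ x →
    count p (M [ i ]≔ x′) + 𝟙 (p x) ≡ count p M + 𝟙 (p x′)
  count-update p (x ∷ M) zero {x′ = x′} refl = lemma (𝟙 (p x′)) (count p M) (𝟙 (p x))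
    where lemma : ∀ u v w → u + v + w ≡ w + v + u
          lemma = solve-∀
  count-update p (m ∷ M) (suc i) {x} {x′} eq = begin
    𝟙 (p m) + count p (M [ i ]≔ x′) + 𝟙 (p x)    ≡⟨ +-assoc (𝟙 (p m)) _ _ ⟩
    𝟙 (p m) + (count p (M [ i ]≔ x′) + 𝟙 (p x))  ≡⟨ cong (𝟙 (p m) +_) (count-update p M i eq) ⟩
    𝟙 (p m) + (count p M + 𝟙 (p x′))             ≡⟨ +-assoc (𝟙 (p m)) _ _ ⟨
    𝟙 (p m) + count p M + 𝟙 (p x′)               ∎
    where open ≡-Reasoning

  ∈-free⁻ : ∀ {n y β} (M : Face n) i → lookup M i ≡ fixed → y ∈ M [ i ]≔ free β →
            y ∈ M ⊎ ∃ λ y₀ → y₀ ∈ M × y ≡ flip y₀ i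
  ∈-free⁻ (fixed ∷ M) zero refl (free {b = false} y∈M) = inj₁ (fixed y∈M)
  ∈-free⁻ (fixed ∷ M) zero refl (free {b = true}  y∈M) = inj₂ (_ , fixed y∈M , refl)
  ∈-free⁻ (fixed ∷ M) (suc i) eq (fixed y∈M) with ∈-free⁻ M i eq y∈M
  ... | inj₁ y∈M′              = inj₁ (fixed y∈M′)
  ... | inj₂ (_ , y₀∈M , refl) = inj₂ (_ , fixed y₀∈M , refl)
  ∈-free⁻ (free _ ∷ M) (suc i) eq (free y∈M) with ∈-free⁻ M i eq y∈M
  ... | inj₁ y∈M′              = inj₁ (free y∈M′)
  ... | inj₂ (_ , y₀∈M , refl) = inj₂ (_ , free y₀∈M , refl)

  ∈-fixed⁻ : ∀ {n y β} (M : Face n) i → lookup M i ≡ free β → y ∈ M [ i ]≔ fixed →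
             y ∈ M × lookup y i ≡ false
  ∈-fixed⁻ (free _ ∷ M) zero    refl (fixed y∈M) = free y∈M , refl
  ∈-fixed⁻ (fixed ∷ M)  (suc i) eq   (fixed y∈M) with ∈-fixed⁻ M i eq y∈M
  ... | y∈M′ , yᵢ = fixed y∈M′ , yᵢ
  ∈-fixed⁻ (free _ ∷ M) (suc i) eq   (free y∈M) with ∈-fixed⁻ M i eq y∈M
  ... | y∈M′ , yᵢ = free y∈M′ , yᵢ

  𝟎 : ∀ {n} → Input n
  𝟎 = replicate _ false

  𝟎-∈ : ∀ {n} (M : Face n) → 𝟎 ∈ M
  𝟎-∈ []           = []
  𝟎-∈ (fixed ∷ M)  = fixed (𝟎-∈ M)
  𝟎-∈ (free _ ∷ M) = free (𝟎-∈ M)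

  lookup-𝟎 : ∀ {n} (i : Fin n) → lookup 𝟎 i ≡ false
  lookup-𝟎 i = lookup-replicate i false

  lookup-flip-𝟎 : ∀ {n} (i : Fin n) → lookup (flip 𝟎 i) i ≡ true
  lookup-flip-𝟎 i = trans (lookup∘updateAt i 𝟎) (cong not (lookup-𝟎 i))

  xor-falseʳ : ∀ σ {b} → b ≡ false → σ xor b ≡ σ
  xor-falseʳ false refl = refl
  xor-falseʳ true  refl = refl

  fixed-free : ∀ {n} (M : Face n) {i j} → lookup M i ≡ fixed → Free M j → i ≢ j
  fixed-free M eq (β , eq′) refl with trans (sym eq) eq′
  ... | ()

  free-free : ∀ {n} (M : Face n) {i j} → lookup M i ≡ free true → lookup M j ≡ free false → i ≢ j
  free-free M eq eq′ refl with trans (sym eq) eq′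
  ... | ()

  true≢false : ∀ {b} → b ≡ true → b ≡ false → ⊥
  true≢false refl ()

  choose : ∀ {n} {P : Fin n → Set} {Q : Set} → (∀ i → P i ⊎ Q) → (∀ i → P i) ⊎ Q
  choose {zero}  f = inj₁ λ ()
  choose {suc n} f with f zero | choose (f ∘ suc)
  ... | inj₂ q | _      = inj₂ q
  ... | inj₁ _ | inj₂ q = inj₂ q
  ... | inj₁ p | inj₁ r = inj₁ λ where
    zero    → p
    (suc i) → r i

  -- The function across a fixed coordinate

  module Certificates {n} (F : BoolFun n) (s₀ : ℕ)
    (s₁≤2 : ∀ {y i j k} → i ≢ j → i ≢ k → j ≢ k → F y ≡ true →
            F (flip y i) ≡ false → F (flip y j) ≡ false → F (flip y k) ≡ true)
    (s₀-bound : ∀ {y} → F y ≡ false → sum (λ i → 𝟙 (F (flip y i))) ≤ s₀)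
    where

    Vanishes : Face n → Set
    Vanishes M = ∀ {y} → y ∈ M → F y ≡ false

    across : Fin n → BoolFun n
    across i y = F (flip y i)

    -- At a 1-point `y` of `across i`, the 1-input `flip y i` of `F` is sensitive at `i`, since `F`
    -- vanishes on `M`. This leaves room for one further sensitive coordinate.
    across-sensitive : ∀ {M i} → Vanishes M → lookup M i ≡ fixed → OneSensitive M (across i)
    across-sensitive {M} {i} van fx {y} {j} {k} y∈M fr fr′ j≢k gy gyj =
      trans (cong F (updateAt-commutes i k i≢k y))
        (s₁≤2 i≢j i≢k j≢k gy (trans (cong F (flip-flip y i)) (van y∈M))
          (trans (cong F (sym (updateAt-commutes i j i≢j y))) gyj))
      where
      i≢j = fixed-free M fx fr
      i≢k = fixed-free M fx fr′

    -- At each point of `M` at most `s₀` of the functions `across i` are 1, so by linearity of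
    -- expectation their probabilities sum to at most `s₀`. Here `v i` bounds the i-th probability,
    -- scaled by (a + d)², from below.
    average : ∀ {M} → Vanishes M → ∀ a d → 0 < a + d → (v : Fin n → ℕ) →
      (∀ i → v i * (a + d) ^ n ≤ (a + d) * (a + d) * E a d M (𝟙 ∘ across i)) →
      sum v ≤ (a + d) * (a + d) * s₀
    average {M} van a d c>0 v v≤ = *-cancelʳ-≤ _ _ N ⦃ m^n≢0 c n ⦄ (begin
      sum v * N                                     ≡⟨ *-distribʳ-sum N v ⟩
      sum (λ i → v i * N)                           ≤⟨ sum-mono v≤ ⟩
      sum (λ i → c * c * E a d M (𝟙 ∘ across i))    ≡⟨ *-distribˡ-sum (c * c) (λ i → E a d M (𝟙 ∘ across i)) ⟨
      c * c * sum (λ i → E a d M (𝟙 ∘ across i))    ≡⟨ cong (c * c *_) (E-sum a d M (λ i → 𝟙 ∘ across i)) ⟨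
      c * c * E a d M (λ y → sum (λ i → 𝟙 (across i y))) ≤⟨ *-monoʳ-≤ (c * c) (E-mono a d M (λ y∈M → s₀-bound (van y∈M))) ⟩
      c * c * E a d M (λ _ → s₀)                    ≡⟨ cong (c * c *_) (E-const a d M s₀) ⟩
      c * c * (s₀ * N)                              ≡⟨ *-assoc (c * c) s₀ N ⟨
      c * c * s₀ * N                                ∎)
      where
      open ≤-Reasoning
      c = a + d
      N = c ^ n
      instance c≢0 = >-nonZero c>0

    -- Exchanges of coordinates in a minimal certificate

    module Minimal (M : Face n) (van : Vanishes M)
      (no-true : ∀ i → lookup M i ≢ free true)
      (minimal : ∀ N → Vanishes N → codimension M ≤ codimension N)
      where

      Literal : Face n → BoolFun n → Set
      Literal N g = ∃ λ j → ∃ λ σ → Free N j × (∀ {y} → y ∈ N → g y ≡ σ xor lookup y j)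

      -- If `across i` were null, `i` could be freed: `F` would vanish on a subcube with one fixed
      -- coordinate fewer, against minimality.
      non-null : ∀ {N i} → Vanishes N → codimension N ≡ codimension M → lookup N i ≡ fixed →
                 Literal N (across i) ⊎ Heavy N (across i)
      non-null {N} {i} vanN size fx with shape N (across i) (across-sensitive vanN fx)
      ... | literal j σ fr lit = inj₁ (j , σ , fr , lit)
      ... | heavy hv           = inj₂ hv
      ... | null z             = contradiction (minimal N′ vanN′) (<⇒≱ smaller)
        where
        N′ = N [ i ]≔ free false
        vanN′ : Vanishes N′
        vanN′ y∈N′ with ∈-free⁻ N i fx y∈N′
        ... | inj₁ y∈N               = vanN y∈N
        ... | inj₂ (_ , y₀∈N , refl) = z y₀∈N
        smaller : codimension N′ < codimension M
        smaller = ≤-reflexive (begin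
          suc (codimension N′)   ≡⟨ +-comm 1 _ ⟩
          codimension N′ + 1     ≡⟨ count-update isFixed N i fx ⟩
          codimension N + 0      ≡⟨ +-identityʳ _ ⟩
          codimension N          ≡⟨ size ⟩
          codimension M          ∎)
          where open ≡-Reasoning

      data Kind (i : Fin n) : Set where
        unfixed : Free M i → Kind i
        light   : lookup M i ≡ fixed → Literal M (across i) → Kind i
        heavy   : lookup M i ≡ fixed → Heavy M (across i) → Kind i

      kind : ∀ i → Kind i
      kind i with lookup M i in eq
      ... | free β = unfixed (β , eq)
      ... | fixed with non-null van refl eq
      ...   | inj₁ l = light eq l
      ...   | inj₂ h = heavy eq h

      isHeavy : ∀ {i} → Kind i → Bool
      isHeavy (unfixed _) = false
      isHeavy (light _ _) = false
      isHeavy (heavy _ _) = true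

      -- Invariant of a sequence of exchanges starting from `M`: preferred value 1 marks coordinates
      -- fixed in `M`, while those with preferred value 0 were free in `M` already.
      record Exchanged (N : Face n) : Set where
        field
          vanishes : Vanishes N
          size     : codimension N ≡ codimension M
          true⇒    : ∀ {i} → lookup N i ≡ free true → lookup M i ≡ fixed
          false⇒   : ∀ {i} → lookup N i ≡ free false → lookup M i ≡ free false

      -- On the union of `N` and its flip across `i`, every 1-point of `F` lies in the flip and has
      -- y_j = 1, so fixing y_j = 0 removes them all. One cell `free false` is used up, as `i` is
      -- freed with preferred value 1.
      exchange : ∀ {N i j} → Exchanged N → lookup M i ≡ fixed → lookup N i ≡ fixed →
        lookup N j ≡ free false → (∀ {y} → y ∈ N → across i y ≡ lookup y j) →
        ∃ λ N′ → Exchanged N′ × suc (count isFalse N′) ≡ count isFalse N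
      exchange {N} {i} {j} ex Mi Ni Nj lit = N′ , record
        { vanishes = vanishes′
        ; size     = trans (+-cancelʳ-≡ 0 _ _ (trans codim₂ codim₁)) size
        ; true⇒    = true⇒′
        ; false⇒   = false⇒′
        } , trans (+-comm 1 _) (trans false₂ (trans (cong (_+ 0) false₁) (+-identityʳ _)))
        where
        open Exchanged ex
        N₁ = N [ i ]≔ free true
        N′ = N₁ [ j ]≔ fixed
        i≢j : i ≢ j
        i≢j = fixed-free N Ni (false , Nj)
        N₁j : lookup N₁ j ≡ free false
        N₁j = trans (lookup∘updateAt′ j i (i≢j ∘ sym) N) Nj
        codim₁ : codimension N₁ + 1 ≡ codimension N + 0
        codim₁ = count-update isFixed N i Ni
        codim₂ : codimension N′ + 0 ≡ codimension N₁ + 1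
        codim₂ = count-update isFixed N₁ j N₁j
        false₁ : count isFalse N₁ ≡ count isFalse N
        false₁ = +-cancelʳ-≡ 0 _ _ (count-update isFalse N i Ni)
        false₂ : count isFalse N′ + 1 ≡ count isFalse N₁ + 0
        false₂ = count-update isFalse N₁ j N₁j
        vanishes′ : Vanishes N′
        vanishes′ {y} y∈N′ with ∈-fixed⁻ N₁ j N₁j y∈N′
        ... | y∈N₁ , yⱼ with ∈-free⁻ N i Ni y∈N₁
        ...   | inj₁ y∈N                = vanishes y∈N
        ...   | inj₂ (y₀ , y₀∈N , refl) =
          trans (lit y₀∈N) (trans (sym (lookup∘updateAt′ j i (i≢j ∘ sym) y₀)) yⱼ)
        lookup-N′ : ∀ {k} → k ≢ j → lookup N′ k ≡ lookup N₁ k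
        lookup-N′ {k} k≢j = lookup∘updateAt′ k j k≢j N₁
        N′j : lookup N′ j ≡ fixed
        N′j = lookup∘updateAt j N₁
        true⇒′ : ∀ {k} → lookup N′ k ≡ free true → lookup M k ≡ fixed
        true⇒′ {k} eq with k Fin.≟ i
        ... | yes refl = Mi
        ... | no  k≢i  = true⇒ (trans (sym (lookup∘updateAt′ k i k≢i N))
          (trans (sym (lookup-N′ (fixed-free N′ N′j (true , eq) ∘ sym))) eq))
        false⇒′ : ∀ {k} → lookup N′ k ≡ free false → lookup M k ≡ free false
        false⇒′ {k} eq = false⇒ (trans (sym (lookup∘updateAt′ k i k≢i N)) N₁k)
          where
          N₁k : lookup N₁ k ≡ free false
          N₁k = trans (sym (lookup-N′ (fixed-free N′ N′j (false , eq) ∘ sym))) eq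
          k≢i : k ≢ i
          k≢i = free-free N₁ (lookup∘updateAt i N) N₁k ∘ sym

      -- A literal is aligned if it is satisfied by the preferred value of its
      -- coordinate.
      data Kind′ (N : Face n) (i : Fin n) (κ : Kind i) : Set where
        unfixed    : Free N i → Kind′ N i κ
        aligned    : lookup N i ≡ fixed → ∀ j σ {β} → lookup N j ≡ free β → σ xor β ≡ true →
                     (∀ {y} → y ∈ N → across i y ≡ σ xor lookup y j) → Kind′ N i κ
        heavy      : lookup N i ≡ fixed → Heavy N (across i) → Kind′ N i κ
        misaligned : lookup N i ≡ fixed → Literal N (across i) → isHeavy κ ≡ true → Kind′ N i κ

      -- A misaligned literal ¬ y_j with i light in M would give flip 𝟎 i
      -- sensitivity 3: at i, at the coordinate k of the literal in M, and at j.
      classify : ∀ {N} → Exchanged N → ∀ i (κ : Kind i) →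
        Kind′ N i κ ⊎ ∃ λ N′ → Exchanged N′ × suc (count isFalse N′) ≡ count isFalse N
      classify {N} ex i κ with lookup N i in Ni
      ... | free β = inj₁ (unfixed (β , Ni))
      ... | fixed with non-null (Exchanged.vanishes ex) (Exchanged.size ex) Ni
      ...   | inj₂ hv = inj₁ (heavy Ni hv)
      ...   | inj₁ (j , true  , (false , Nj) , lit) = inj₁ (aligned Ni j true Nj refl lit)
      ...   | inj₁ (j , false , (true  , Nj) , lit) = inj₁ (aligned Ni j false Nj refl lit)
      ...   | inj₁ (j , false , (false , Nj) , lit) = exchangeable κ
        where
        open Exchanged ex
        exchangeable : ∀ κ → Kind′ N i κ ⊎ _
        exchangeable (light Mi _) = inj₂ (exchange ex Mi Ni Nj lit)
        exchangeable (heavy Mi _) = inj₂ (exchange ex Mi Ni Nj lit)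
        -- With `i` and `j` both free in `M`, flipping both at the origin stays in `M`, where `F` is
        -- 0, whereas the literal gives 1.
        exchangeable (unfixed fr) = ⊥-elim (true≢false
          (trans (lit (flip-∈ j (false , Nj) (𝟎-∈ N))) (lookup-flip-𝟎 j))
          (van (flip-∈ i fr (flip-∈ j (false , false⇒ Nj) (𝟎-∈ M)))))
      ...   | inj₁ (j , true  , (true  , Nj) , lit) = inj₁ (impossible κ)
        where
        open Exchanged ex
        at-𝟎 : across i 𝟎 ≡ true
        at-𝟎 = trans (lit (𝟎-∈ N)) (cong not (lookup-𝟎 j))
        at-j : across i (flip 𝟎 j) ≡ false
        at-j = trans (lit (flip-∈ j (true , Nj) (𝟎-∈ N))) (cong not (lookup-flip-𝟎 j))
        impossible : ∀ κ → Kind′ N i κ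
        impossible (heavy _ _)  = misaligned Ni (j , true , (true , Nj) , lit) refl
        impossible (unfixed fr) = ⊥-elim (true≢false at-𝟎 (van (flip-∈ i fr (𝟎-∈ M))))
        impossible (light Mi (k , σ , fr , lit′)) = ⊥-elim (true≢false
          (s₁≤2 i≢k i≢j k≢j at-𝟎
            (trans (cong F (flip-flip 𝟎 i)) (van (𝟎-∈ M)))
            (trans (cong F (sym (updateAt-commutes i k i≢k 𝟎))) at-k))
          (trans (cong F (sym (updateAt-commutes i j i≢j 𝟎))) at-j))
          where
          i≢k = fixed-free M Mi fr
          i≢j = fixed-free N Ni (true , Nj)
          k≢j = fixed-free M (true⇒ Nj) fr ∘ sym
          σ≡true : σ ≡ true
          σ≡true = trans (sym (xor-falseʳ σ (lookup-𝟎 k))) (trans (sym (lit′ (𝟎-∈ M))) at-𝟎)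
          at-k : across i (flip 𝟎 k) ≡ false
          at-k = trans (lit′ (flip-∈ k fr (𝟎-∈ M))) (cong₂ _xor_ σ≡true (lookup-flip-𝟎 k))

      -- Each exchange uses up one cell `free false`; their number `k` drives the recursion, and at
      -- 0 a further exchange is absurd.
      exhaust : ∀ k N → Exchanged N → count isFalse N ≡ k →
                ∃ λ N′ → Exchanged N′ × (∀ i → Kind′ N′ i (kind i))
      exhaust k N ex eq with choose (λ i → classify ex i (kind i))
      ... | inj₁ kinds = N , ex , kinds
      exhaust zero    N ex eq | inj₂ (N′ , ex′ , eq′) with trans eq′ eq
      ... | ()
      exhaust (suc k) N ex eq | inj₂ (N′ , ex′ , eq′) =
        exhaust k N′ ex′ (suc-injective (trans eq′ eq))

      -- Four times a lower bound for the probability of `across i` under the uniform measure: 1/2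
      -- for a literal, 3/4 for a heavy function.
      kindWeight : ∀ {i} → Kind i → ℕ
      kindWeight (unfixed _) = 0
      kindWeight (light _ _) = 2
      kindWeight (heavy _ _) = 3

      kindWeight-≤ : ∀ i → kindWeight (kind i) * 2 ^ n ≤ 4 * E 1 1 M (𝟙 ∘ across i)
      kindWeight-≤ i with kind i
      ... | unfixed _ = z≤n
      ... | light _ (j , σ , fr , lit) = begin
        2 * 2 ^ n         ≡⟨ cong (2 *_) (*-identityˡ (2 ^ n)) ⟨
        2 * (1 * 2 ^ n)   ≤⟨ *-monoʳ-≤ 2 (E-literal-≥′ M j σ fr lit (≤-refl {1})) ⟩
        2 * (2 * E 1 1 M (𝟙 ∘ across i)) ≡⟨ *-assoc 2 2 (E 1 1 M (𝟙 ∘ across i)) ⟨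
        4 * E 1 1 M (𝟙 ∘ across i) ∎
        where open ≤-Reasoning
      ... | heavy _ hv = hv 1 1 ≤-refl

      module _ {N : Face n} {i : Fin n} where

        #aligned #heavy #misaligned : {κ : Kind i} → Kind′ N i κ → ℕ
        #aligned (aligned _ _ _ _ _ _) = 1
        #aligned _                     = 0
        #heavy (heavy _ _) = 1
        #heavy _           = 0
        #misaligned (misaligned _ _ _) = 1
        #misaligned _                  = 0

        #-fixed : {κ : Kind i} (κ′ : Kind′ N i κ) →
          #aligned κ′ + #heavy κ′ + #misaligned κ′ ≡ 𝟙 (isFixed (lookup N i))
        #-fixed (unfixed (_ , Ni))         rewrite Ni = refl
        #-fixed (aligned Ni _ _ _ _ _)     rewrite Ni = refl
        #-fixed (heavy Ni _)               rewrite Ni = refl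
        #-fixed (misaligned Ni _ _)        rewrite Ni = refl

        -- A misaligned coordinate is heavy for `M`, so its weight 3 leaves 1 beyond the 2 counted
        -- for a fixed coordinate.
        #misaligned-≤ : (κ : Kind i) (κ′ : Kind′ N i κ) →
          2 * 𝟙 (isFixed (lookup M i)) + #misaligned κ′ ≤ kindWeight κ
        #misaligned-≤ (unfixed (_ , Mi)) (unfixed _)             rewrite Mi = z≤n
        #misaligned-≤ (unfixed (_ , Mi)) (aligned _ _ _ _ _ _)   rewrite Mi = z≤n
        #misaligned-≤ (unfixed (_ , Mi)) (heavy _ _)             rewrite Mi = z≤n
        #misaligned-≤ (light Mi _)       (unfixed _)             rewrite Mi = ≤-refl
        #misaligned-≤ (light Mi _)       (aligned _ _ _ _ _ _)   rewrite Mi = ≤-refl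
        #misaligned-≤ (light Mi _)       (heavy _ _)             rewrite Mi = ≤-refl
        #misaligned-≤ (heavy Mi _)       (unfixed _)             rewrite Mi = n≤1+n 2
        #misaligned-≤ (heavy Mi _)       (aligned _ _ _ _ _ _)   rewrite Mi = n≤1+n 2
        #misaligned-≤ (heavy Mi _)       (heavy _ _)             rewrite Mi = n≤1+n 2
        #misaligned-≤ (heavy Mi _)       (misaligned _ _ _)      rewrite Mi = ≤-refl

        -- The coefficients are ρ, 1 - ρ² and 1 - ρ, scaled by (a + d)².
        weight : ∀ a d {κ : Kind i} → Kind′ N i κ → ℕ
        weight a d κ′ = a * (a + d) * #aligned κ′ + d * (a + (a + d)) * #heavy κ′
                        + d * (a + d) * #misaligned κ′

        weight-≤ : ∀ a d → d ≤ a → {κ : Kind i} (κ′ : Kind′ N i κ) →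
          weight a d κ′ * (a + d) ^ n ≤ (a + d) * (a + d) * E a d N (𝟙 ∘ across i)
        weight-≤ a d d≤a (unfixed _) = ≤-trans (≤-reflexive (cong (_* (a + d) ^ n) (lemma (a * (a + d)) (d * (a + (a + d))) (d * (a + d))))) z≤n
          where lemma : ∀ u v w → u * 0 + v * 0 + w * 0 ≡ 0
                lemma = solve-∀
        weight-≤ a d d≤a κ′@(aligned _ j σ {β} Nj al lit) = begin
          weight a d κ′ * c ^ n ≡⟨ lemma a c (d * (a + (a + d))) (d * (a + d)) (c ^ n) ⟩
          c * (a * c ^ n)      ≡⟨ cong (λ b → c * ((if b then a else d) * c ^ n)) al ⟨
          c * ((if σ xor β then a else d) * c ^ n) ≤⟨ *-monoʳ-≤ c (E-literal-≥ N j σ Nj lit a d) ⟩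
          c * (c * E a d N (𝟙 ∘ across i)) ≡⟨ *-assoc c c _ ⟨
          c * c * E a d N (𝟙 ∘ across i) ∎
          where
          open ≤-Reasoning
          c = a + d
          lemma : ∀ a c v w N → (a * c * 1 + v * 0 + w * 0) * N ≡ c * (a * N)
          lemma = solve-∀
        weight-≤ a d d≤a (heavy _ hv) = ≤-trans (≤-reflexive (cong (_* (a + d) ^ n) (lemma (a * (a + d)) (d * (a + (a + d))) (d * (a + d))))) (hv a d d≤a)
          where lemma : ∀ u v w → u * 0 + v * 1 + w * 0 ≡ v
                lemma = solve-∀
        weight-≤ a d d≤a κ′@(misaligned _ (j , σ , fr , lit) _) = begin
          weight a d κ′ * c ^ n ≡⟨ lemma d c (a * (a + d)) (d * (a + (a + d))) (c ^ n) ⟩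
          c * (d * c ^ n)      ≤⟨ *-monoʳ-≤ c (E-literal-≥′ N j σ fr lit d≤a) ⟩
          c * (c * E a d N (𝟙 ∘ across i)) ≡⟨ *-assoc c c _ ⟨
          c * c * E a d N (𝟙 ∘ across i) ∎
          where
          open ≤-Reasoning
          c = a + d
          lemma : ∀ d c v w N → (v * 0 + w * 0 + d * c * 1) * N ≡ c * (d * N)
          lemma = solve-∀

      sum-+₃ : ∀ {k} (u v w : Fin k → ℕ) → sum u + sum v + sum w ≡ sum (λ i → u i + v i + w i)
      sum-+₃ u v w = sym (trans (∑-distrib-+ (λ i → u i + v i) w) (cong (_+ sum w) (∑-distrib-+ u v)))

      inequalities : ∃ λ X → ∃ λ H → ∃ λ K →
        X + H + K ≡ codimension M × 2 * codimension M + K ≤ 4 * s₀ ×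
        (∀ a d → d ≤ a → 0 < a + d →
          a * (a + d) * X + d * (a + (a + d)) * H + d * (a + d) * K ≤ (a + d) * (a + d) * s₀)
      inequalities
        -- The exchanges start from `M` itself, which has no cell `free true`.
        with exhaust _ M record { vanishes = van ; size = refl
                                ; true⇒ = λ {i} eq → contradiction eq (no-true i)
                                ; false⇒ = λ eq → eq } refl
      ... | N , ex , kinds = sum x , sum h , sum k
          , trans (trans (sum-+₃ x h k) (sum-cong-≗ (λ i → #-fixed (kinds i)))) (Exchanged.size ex)
          , (begin
              2 * codimension M + sum k       ≡⟨ cong (_+ sum k) (*-distribˡ-sum 2 f) ⟩
              sum (λ i → 2 * f i) + sum k     ≡⟨ ∑-distrib-+ (λ i → 2 * f i) k ⟨
              sum (λ i → 2 * f i + k i)       ≤⟨ sum-mono (λ i → #misaligned-≤ (kind i) (kinds i)) ⟩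
              -- This average is over the original `M` with ρ = 1/2; the one below is over the
              -- exchanged face with general ρ.
              sum (λ i → kindWeight (kind i)) ≤⟨ average van 1 1 (s≤s z≤n) _ kindWeight-≤ ⟩
              4 * s₀                          ∎)
          , λ a d d≤a c>0 → let u = a * (a + d) ; v = d * (a + (a + d)) ; w = d * (a + d) in begin
              u * sum x + v * sum h + w * sum k
                ≡⟨ cong₂ _+_ (cong₂ _+_ (*-distribˡ-sum u x) (*-distribˡ-sum v h)) (*-distribˡ-sum w k) ⟩
              sum (λ i → u * x i) + sum (λ i → v * h i) + sum (λ i → w * k i)
                ≡⟨ sum-+₃ (λ i → u * x i) (λ i → v * h i) (λ i → w * k i) ⟩
              sum (λ i → weight a d (kinds i))
                ≤⟨ average (Exchanged.vanishes ex) a d c>0 _ (λ i → weight-≤ a d d≤a (kinds i)) ⟩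
              (a + d) * (a + d) * s₀ ∎
        where
        open ≤-Reasoning
        x = λ i → #aligned (kinds i)
        h = λ i → #heavy (kinds i)
        k = λ i → #misaligned (kinds i)
        f = λ i → 𝟙 (isFixed (lookup M i))

  -- Arithmetic of the bound

  -- m ≤ (37 + √5) / 22 · s, with √5 eliminated by squaring.
  Bound : ℕ → ℕ → Set
  Bound m s = 22 * m ≤ 37 * s ⊎ ∃ λ e → 22 * m ≡ 37 * s + e × e * e ≤ 5 * (s * s)

  2xy≤x²+y² : ∀ x y → 2 * x * y ≤ x * x + y * y
  2xy≤x²+y² x y with ≤-total x y
  ... | inj₁ x≤y with m≤n⇒∃[o]m+o≡n x≤y
  ...   | t , refl = ≤-trans (m≤m+n _ (t * t)) (≤-reflexive (lemma x t))
    where lemma : ∀ x t → 2 * x * (x + t) + t * t ≡ x * x + (x + t) * (x + t)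
          lemma = solve-∀
  2xy≤x²+y² x y | inj₂ y≤x with m≤n⇒∃[o]m+o≡n y≤x
  ...   | t , refl = ≤-trans (m≤m+n _ (t * t)) (≤-reflexive (lemma y t))
    where lemma : ∀ y t → 2 * (y + t) * y + t * t ≡ (y + t) * (y + t) + y * y
          lemma = solve-∀

  -- 16/9 lies below the constant: 22 · 16/9 - 37 = 19/9, and (19/9)² = 361/81 is less than 5 =
  -- 405/81.
  bound-16/9 : ∀ m s → 9 * m ≤ 16 * s → Bound m s
  bound-16/9 m s 9m≤16s with ≤-total (22 * m) (37 * s)
  ... | inj₁ le = inj₁ le
  ... | inj₂ ge with m≤n⇒∃[o]m+o≡n ge
  ...   | e , eq = inj₂ (e , sym eq , *-cancelˡ-≤ 81 (begin
    81 * (e * e)           ≡⟨ lemma₁ e ⟩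
    (9 * e) * (9 * e)      ≤⟨ *-mono-≤ 9e≤19s 9e≤19s ⟩
    (19 * s) * (19 * s)    ≤⟨ m≤m+n _ (44 * (s * s)) ⟩
    (19 * s) * (19 * s) + 44 * (s * s) ≡⟨ lemma₂ s ⟩
    81 * (5 * (s * s))     ∎))
    where
    open ≤-Reasoning
    lemma₁ : ∀ e → 81 * (e * e) ≡ (9 * e) * (9 * e)
    lemma₁ = solve-∀
    lemma₂ : ∀ s → (19 * s) * (19 * s) + 44 * (s * s) ≡ 81 * (5 * (s * s))
    lemma₂ = solve-∀
    lemma₃ : ∀ s e → 333 * s + 9 * e ≡ 9 * (37 * s + e)
    lemma₃ = solve-∀
    lemma₄ : ∀ m → 9 * (22 * m) ≡ 22 * (9 * m)
    lemma₄ = solve-∀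
    lemma₅ : ∀ s → 22 * (16 * s) ≡ 333 * s + 19 * s
    lemma₅ = solve-∀
    9e≤19s : 9 * e ≤ 19 * s
    9e≤19s = +-cancelˡ-≤ (333 * s) _ _ (begin
      333 * s + 9 * e    ≡⟨ lemma₃ s e ⟩
      9 * (37 * s + e)   ≡⟨ cong (9 *_) eq ⟩
      9 * (22 * m)       ≡⟨ lemma₄ m ⟩
      22 * (9 * m)       ≤⟨ *-monoʳ-≤ 22 9m≤16s ⟩
      22 * (16 * s)      ≡⟨ lemma₅ s ⟩
      333 * s + 19 * s   ∎)

  -- κ stands for 4 s - 2 m, the largest possible K.
  bound-quadratic : ∀ {m s} κ G → m ≡ 2 * κ + G → 4 * s ≡ 5 * κ + 2 * G →
    4 * (G * G) ≤ κ * κ + 8 * (κ * G) → Bound m s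
  bound-quadratic {m} {s} κ G eqₘ eqₛ q with ≤-total (22 * m) (37 * s)
  ... | inj₁ le = inj₁ le
  ... | inj₂ ge with m≤n⇒∃[o]m+o≡n ge
  -- As 4 e = 14 G - 9 κ, the claim times 16 reads (14 G - 9 κ)² ≤ 5 (5 κ + 2 G)², which rearranges
  -- to 44 times `q`. The term 252 κ G on both sides avoids subtraction.
  ...   | e , eq = inj₂ (e , sym eq , *-cancelˡ-≤ 16 (+-cancelʳ-≤ (252 * (κ * G)) _ _ (begin
    16 * (e * e) + 252 * (κ * G)                    ≡⟨ lemma₁ e κ G ⟩
    16 * (e * e) + 18 * (κ * (14 * G))              ≡⟨ cong (λ t → 16 * (e * e) + 18 * (κ * t)) 4e+9κ ⟨
    16 * (e * e) + 18 * (κ * (4 * e + 9 * κ))       ≡⟨ lemma₂ e κ ⟩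
    (4 * e + 9 * κ) * (4 * e + 9 * κ) + 81 * (κ * κ) ≡⟨ cong (λ t → t * t + 81 * (κ * κ)) 4e+9κ ⟩
    14 * G * (14 * G) + 81 * (κ * κ)                ≡⟨ lemma₃ G κ ⟩
    44 * (4 * (G * G)) + (20 * (G * G) + 81 * (κ * κ)) ≤⟨ +-monoˡ-≤ _ (*-monoʳ-≤ 44 q) ⟩
    44 * (κ * κ + 8 * (κ * G)) + (20 * (G * G) + 81 * (κ * κ)) ≡⟨ lemma₄ G κ ⟩
    5 * ((5 * κ + 2 * G) * (5 * κ + 2 * G)) + 252 * (κ * G) ≡⟨ cong (λ t → 5 * (t * t) + 252 * (κ * G)) eqₛ ⟨
    5 * (4 * s * (4 * s)) + 252 * (κ * G)           ≡⟨ cong (_+ 252 * (κ * G)) (lemma₅ s) ⟩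
    16 * (5 * (s * s)) + 252 * (κ * G)              ∎)))
    where
    open ≤-Reasoning
    lemma₁ : ∀ e κ G → 16 * (e * e) + 252 * (κ * G) ≡ 16 * (e * e) + 18 * (κ * (14 * G))
    lemma₁ = solve-∀
    lemma₂ : ∀ e κ → 16 * (e * e) + 18 * (κ * (4 * e + 9 * κ)) ≡ (4 * e + 9 * κ) * (4 * e + 9 * κ) + 81 * (κ * κ)
    lemma₂ = solve-∀
    lemma₃ : ∀ G κ → 14 * G * (14 * G) + 81 * (κ * κ) ≡ 44 * (4 * (G * G)) + (20 * (G * G) + 81 * (κ * κ))
    lemma₃ = solve-∀
    lemma₄ : ∀ G κ → 44 * (κ * κ + 8 * (κ * G)) + (20 * (G * G) + 81 * (κ * κ)) ≡ 5 * ((5 * κ + 2 * G) * (5 * κ + 2 * G)) + 252 * (κ * G)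
    lemma₄ = solve-∀
    lemma₅ : ∀ s → 5 * (4 * s * (4 * s)) ≡ 16 * (5 * (s * s))
    lemma₅ = solve-∀
    4e+9κ : 4 * e + 9 * κ ≡ 14 * G
    4e+9κ = +-cancelʳ-≡ (37 * (5 * κ + 2 * G)) _ _ (begin-equality
      4 * e + 9 * κ + 37 * (5 * κ + 2 * G)  ≡⟨ cong (λ t → 4 * e + 9 * κ + 37 * t) eqₛ ⟨
      4 * e + 9 * κ + 37 * (4 * s)          ≡⟨ lemma₆ e κ s ⟩
      4 * (37 * s + e) + 9 * κ              ≡⟨ cong (λ t → 4 * t + 9 * κ) eq ⟩
      4 * (22 * m) + 9 * κ                  ≡⟨ cong (λ t → 4 * (22 * t) + 9 * κ) eqₘ ⟩
      4 * (22 * (2 * κ + G)) + 9 * κ        ≡⟨ lemma₇ κ G ⟩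
      14 * G + 37 * (5 * κ + 2 * G)         ∎)
      where
      lemma₆ : ∀ e κ s → 4 * e + 9 * κ + 37 * (4 * s) ≡ 4 * (37 * s + e) + 9 * κ
      lemma₆ = solve-∀
      lemma₇ : ∀ κ G → 4 * (22 * (2 * κ + G)) + 9 * κ ≡ 14 * G + 37 * (5 * κ + 2 * G)
      lemma₇ = solve-∀

  -- The difference of the two sides is 20 (H κ - u² - H²) + (κ + 4 u - 2 H)².
  quadratic : ∀ κ u H → u * u + H * H ≤ H * κ →
    4 * ((2 * H + u) * (2 * H + u)) ≤ κ * κ + 8 * (κ * (2 * H + u))
  quadratic κ u H v = +-cancelʳ-≤ (20 * (H * κ) + q) _ _ (begin
    4 * ((2 * H + u) * (2 * H + u)) + (20 * (H * κ) + q)           ≡⟨ lemma κ u H ⟩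
    r + (20 * (u * u + H * H) + 2 * (κ + 4 * u) * (2 * H))         ≤⟨ +-monoʳ-≤ r (+-mono-≤ (*-monoʳ-≤ 20 v) (2xy≤x²+y² (κ + 4 * u) (2 * H))) ⟩
    r + (20 * (H * κ) + q)                                         ∎)
    where
    open ≤-Reasoning
    q = (κ + 4 * u) * (κ + 4 * u) + 2 * H * (2 * H)
    r = κ * κ + 8 * (κ * (2 * H + u))
    lemma : ∀ κ u H →
      4 * ((2 * H + u) * (2 * H + u)) + (20 * (H * κ) + ((κ + 4 * u) * (κ + 4 * u) + 2 * H * (2 * H)))
      ≡ κ * κ + 8 * (κ * (2 * H + u)) + (20 * (u * u + H * H) + 2 * (κ + 4 * u) * (2 * H))
    lemma = solve-∀

  -- Once K is replaced by its largest possible value 4 s - 2 m, the left-hand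
  -- side is maximal at ρ = (H + u) / 2 H, where u = 5 m - 8 s - 2 H.  If this is
  -- not in [1/2, 1], the nearest endpoint suffices.
  bound : ∀ {m s} → (∃ λ X → ∃ λ H → ∃ λ K → X + H + K ≡ m × 2 * m + K ≤ 4 * s ×
    (∀ a d → d ≤ a → 0 < a + d →
      a * (a + d) * X + d * (a + (a + d)) * H + d * (a + d) * K ≤ (a + d) * (a + d) * s)) →
    Bound m s
  bound {_} {s} (X , H , K , refl , le , ineq) with 5 * (X + H + K) ≤? 8 * s + 2 * H
  -- The case u ≤ 0, settled by ρ = 1/2.
  ... | yes 5m≤ = bound-16/9 m s (begin
    9 * m                          ≡⟨ lemma₁ X H K ⟩
    5 * m + 4 * m                  ≤⟨ +-monoˡ-≤ (4 * m) 5m≤ ⟩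
    8 * s + 2 * H + 4 * m          ≡⟨ lemma₂ s X H K ⟩
    8 * s + 2 * (2 * X + 3 * H + 2 * K) ≤⟨ +-monoʳ-≤ (8 * s) (*-monoʳ-≤ 2 (ineq 1 1 ≤-refl (s≤s z≤n))) ⟩
    8 * s + 2 * (4 * s)            ≡⟨ lemma₃ s ⟩
    16 * s                         ∎)
    where
    open ≤-Reasoning
    m = X + H + K
    lemma₁ : ∀ X H K → 9 * (X + H + K) ≡ 5 * (X + H + K) + 4 * (X + H + K)
    lemma₁ = solve-∀
    lemma₂ : ∀ s X H K → 8 * s + 2 * H + 4 * (X + H + K) ≡ 8 * s + 2 * (2 * X + 3 * H + 2 * K)
    lemma₂ = solve-∀
    lemma₃ : ∀ s → 8 * s + 2 * (4 * s) ≡ 16 * s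
    lemma₃ = solve-∀
  ... | no 5m≰ with 8 * s + 3 * H ≤? 5 * (X + H + K)
  -- The case u ≥ H: at ρ = 1 the inequality is `X ≤ s`, which yields m ≤ 7/4 s, and 7/4 < 16/9.
  ...   | yes 5m≥ = bound-16/9 m s (*-cancelˡ-≤ 4 (begin
    4 * (9 * m)     ≡⟨ lemma₁ m ⟩
    9 * (4 * m)     ≤⟨ *-monoʳ-≤ 9 4m≤7s ⟩
    9 * (7 * s)     ≤⟨ m≤m+n _ s ⟩
    9 * (7 * s) + s ≡⟨ lemma₂ s ⟩
    4 * (16 * s)    ∎))
    where
    open ≤-Reasoning
    m = X + H + K
    lemma₁ : ∀ m → 4 * (9 * m) ≡ 9 * (4 * m)
    lemma₁ = solve-∀
    lemma₂ : ∀ s → 9 * (7 * s) + s ≡ 4 * (16 * s)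
    lemma₂ = solve-∀
    lemma₃ : ∀ X H K s → 4 * (X + H + K) + (5 * (X + H + K) + 8 * s)
      ≡ 3 * X + (8 * s + 3 * H) + 3 * (2 * (X + H + K) + K)
    lemma₃ = solve-∀
    lemma₄ : ∀ m s → 3 * s + 5 * m + 3 * (4 * s) ≡ 7 * s + (5 * m + 8 * s)
    lemma₄ = solve-∀
    4m≤7s : 4 * m ≤ 7 * s
    4m≤7s = +-cancelʳ-≤ (5 * m + 8 * s) _ _ (begin
      4 * m + (5 * m + 8 * s)                            ≡⟨ lemma₃ X H K s ⟩
      3 * X + (8 * s + 3 * H) + 3 * (2 * m + K)
        ≤⟨ +-mono-≤ (+-mono-≤ (*-monoʳ-≤ 3 X≤s) 5m≥) (*-monoʳ-≤ 3 le) ⟩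
      3 * s + 5 * m + 3 * (4 * s)                  ≡⟨ lemma₄ m s ⟩
      7 * s + (5 * m + 8 * s)                            ∎)
      where
      lemma : ∀ X → X ≡ X + 0 + 0 + 0
      lemma = solve-∀
      X≤s : X ≤ s
      X≤s = begin
        X              ≡⟨ lemma X ⟩
        X + 0 + 0 + 0  ≤⟨ ineq 1 0 z≤n (s≤s z≤n) ⟩
        s + 0          ≡⟨ +-identityʳ s ⟩
        s              ∎
  bound {_} {s} (X , H , K , refl , le , ineq) | no 5m≰ | no 5m≱
    with m≤n⇒∃[o]m+o≡n (<⇒≤ (≰⇒> 5m≰)) | m≤n⇒∃[o]m+o≡n le
  ... | u , eqᵤ | δ , eqδ with m≤n⇒∃[o]m+o≡n u≤H
    where
    open ≤-Reasoning
    lemma : ∀ s H → 8 * s + 3 * H ≡ 8 * s + 2 * H + H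
    lemma = solve-∀
    u≤H : u ≤ H
    u≤H = +-cancelˡ-≤ (8 * s + 2 * H) _ _ (begin
      8 * s + 2 * H + u  ≡⟨ eqᵤ ⟩
      5 * (X + H + K)    ≤⟨ <⇒≤ (≰⇒> 5m≱) ⟩
      8 * s + 3 * H      ≡⟨ lemma s H ⟩
      8 * s + 2 * H + H  ∎)
  -- With d = H - u and a = H + u, the quotient a / (a + d) is (H + u) / 2 H. The slack `δ` makes
  -- `κ` equal to 4 s - 2 m, and `G` is m - 2 κ.
  ... | d , refl = bound-quadratic {s = s} κ G eqₘ eqₛ (quadratic κ u H v)
    where
    open ≤-Reasoning
    m = X + H + K
    κ = K + δ
    G = 2 * H + u
    a = H + u
    eqₘ : m ≡ 2 * κ + G
    eqₘ = +-cancelˡ-≡ (2 * (2 * m + K + δ)) _ _ (begin-equality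
      2 * (2 * m + K + δ) + m            ≡⟨ lemma₁ m K δ ⟩
      5 * m + 2 * κ                      ≡⟨ cong (_+ 2 * κ) eqᵤ ⟨
      8 * s + 2 * H + u + 2 * κ          ≡⟨ lemma₂ s H u κ ⟩
      2 * (4 * s) + (2 * κ + G)          ≡⟨ cong (λ t → 2 * t + (2 * κ + G)) eqδ ⟨
      2 * (2 * m + K + δ) + (2 * κ + G)  ∎)
      where
      lemma₁ : ∀ m K δ → 2 * (2 * m + K + δ) + m ≡ 5 * m + 2 * (K + δ)
      lemma₁ = solve-∀
      lemma₂ : ∀ s H u κ → 8 * s + 2 * H + u + 2 * κ ≡ 2 * (4 * s) + (2 * κ + (2 * H + u))
      lemma₂ = solve-∀
    eqₛ : 4 * s ≡ 5 * κ + 2 * G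
    eqₛ = begin-equality
      4 * s                      ≡⟨ eqδ ⟨
      2 * m + K + δ              ≡⟨ cong (λ t → 2 * t + K + δ) eqₘ ⟩
      2 * (2 * κ + G) + K + δ    ≡⟨ lemma K δ G ⟩
      5 * κ + 2 * G              ∎
      where
      lemma : ∀ K δ G → 2 * (2 * (K + δ) + G) + K + δ ≡ 5 * (K + δ) + 2 * G
      lemma = solve-∀
    eqₓ : X ≡ K + 2 * δ + a
    eqₓ = +-cancelʳ-≡ (H + K) _ _ (begin-equality
      X + (H + K)              ≡⟨ +-assoc X H K ⟨
      m                        ≡⟨ eqₘ ⟩
      2 * κ + G                ≡⟨ lemma K δ u H ⟩
      K + 2 * δ + a + (H + K)  ∎)
      where
      lemma : ∀ K δ u H → 2 * (K + δ) + (2 * H + u) ≡ K + 2 * δ + (H + u) + (H + K)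
      lemma = solve-∀
    u≢0 : u ≢ 0
    u≢0 refl = 5m≰ (≤-reflexive (trans (sym eqᵤ) (+-identityʳ _)))
    0<H : 0 < H
    0<H = ≤-trans (n≢0⇒n>0 u≢0) (m≤m+n u d)
    d≤a : d ≤ a
    d≤a = ≤-trans (m≤n+m d u) (m≤m+n H u)
    c>0 : 0 < a + d
    c>0 = ≤-trans 0<H (≤-trans (m≤m+n H u) (m≤m+n a d))
    v : u * u + H * H ≤ H * κ
    -- Divided by 4 H, `ineq a d` amounts to u² + H² + 4 u δ ≤ H κ; the term 4 u δ, which is 0 when
    -- K = κ, is dropped.
    v = *-cancelˡ-≤ (4 * H) ⦃ >-nonZero (≤-trans 0<H (m≤m+n H _)) ⦄ (+-cancelˡ-≤ ((a + d) * (a + d) * (4 * s)) _ _ (begin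
      (a + d) * (a + d) * (4 * s) + 4 * H * (u * u + H * H)
        ≤⟨ +-monoʳ-≤ _ (*-monoʳ-≤ (4 * H) (m≤m+n (u * u + H * H) (4 * u * δ))) ⟩
      (a + d) * (a + d) * (4 * s) + 4 * H * (u * u + H * H + 4 * u * δ)
        ≡⟨ cong (λ t → (a + d) * (a + d) * t + 4 * H * (u * u + H * H + 4 * u * δ)) eqₛ ⟩
      (a + d) * (a + d) * (5 * κ + 2 * G) + 4 * H * (u * u + H * H + 4 * u * δ)
        ≡⟨ lemma₁ u d K δ ⟩
      4 * (a * (a + d) * (K + 2 * δ + a) + d * (a + (a + d)) * H + d * (a + d) * K) + 4 * H * (H * κ)
        ≡⟨ cong (λ t → 4 * (a * (a + d) * t + d * (a + (a + d)) * H + d * (a + d) * K) + 4 * H * (H * κ)) eqₓ ⟨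
      4 * (a * (a + d) * X + d * (a + (a + d)) * H + d * (a + d) * K) + 4 * H * (H * κ)
        ≤⟨ +-monoˡ-≤ _ (*-monoʳ-≤ 4 (ineq a d d≤a c>0)) ⟩
      4 * ((a + d) * (a + d) * s) + 4 * H * (H * κ)
        ≡⟨ cong (_+ 4 * H * (H * κ)) (lemma₂ (a + d) s) ⟩
      (a + d) * (a + d) * (4 * s) + 4 * H * (H * κ) ∎))
      where
      lemma₂ : ∀ c s → 4 * (c * c * s) ≡ c * c * (4 * s)
      lemma₂ = solve-∀
      lemma₁ : ∀ u d K δ → let H = u + d ; κ = K + δ ; G = 2 * H + u ; a = H + u in
        (a + d) * (a + d) * (5 * κ + 2 * G) + 4 * H * (u * u + H * H + 4 * u * δ)
        ≡ 4 * (a * (a + d) * (K + 2 * δ + a) + d * (a + (a + d)) * H + d * (a + d) * K) + 4 * H * (H * κ)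
      lemma₁ = solve-∀

  -- Translation of a 0-input to the origin

  module _ {n} (b : Bool) (f : BoolFun n) (g : Input n → ℕ) where

    ≤-maxOver : ∀ {x} → f x ≡ b → g x ≤ maxOver b f g
    ≤-maxOver {x} eq = All.lookup (xs≤max 0 (List.map g (filter (λ x → f x ≟ᵇ b) (inputs n))))
      (∈-map⁺ g (∈-filter⁺ (λ x → f x ≟ᵇ b) (∈-inputs x) eq))

    -- The maximum is one of the values of `g` or the default 0.
    maxOver-all : (P : ℕ → Set) → P 0 → (∀ x → f x ≡ b → P (g x)) → P (maxOver b f g)
    maxOver-all P p₀ p = argmax-all id {P = P} p₀ (All.tabulate λ {k} k∈ → at k (∈-map⁻ g k∈))
      where
      at : ∀ k → (∃ λ x → _ × k ≡ g x) → P k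
      at _ (x , x∈ , refl) = p x (proj₂ (∈-filter⁻ (λ x → f x ≟ᵇ b) {xs = inputs n} x∈))

  length-filter-tabulate : ∀ {A : Set} {P : A → Set} (P? : Decidable P) {n} (g : Fin n → A) →
    length (filter P? (tabulate g)) ≡ sum (λ i → 𝟙 (does (P? (g i))))
  length-filter-tabulate P? {zero}  g = refl
  length-filter-tabulate P? {suc n} g with does (P? (g zero))
  ... | false = length-filter-tabulate P? (g ∘ suc)
  ... | true  = cong suc (length-filter-tabulate P? (g ∘ suc))

  sensitivity-sum : ∀ {n} (f : BoolFun n) x → sensitivity f x ≡ sum (λ i → 𝟙 (f x xor f (flip x i)))
  sensitivity-sum f x = trans (length-filter-tabulate (λ i → ¬? (f x ≟ᵇ f (flip x i))) id)
    (sum-cong-≗ λ i → cong 𝟙 (lemma (f x) (f (flip x i))))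
    where
    lemma : ∀ a b → does (¬? (a ≟ᵇ b)) ≡ a xor b
    lemma true  true  = refl
    lemma true  false = refl
    lemma false true  = refl
    lemma false false = refl

  -- `v` is `u` with entry `i` replaced by 0.
  sum-split : ∀ {n} (u : Fin n → ℕ) i → ∃ λ v → sum u ≡ u i + sum v × (∀ j → i ≢ j → v j ≡ u j)
  sum-split u zero = (λ { zero → 0 ; (suc j) → u (suc j) }) , refl , λ where
    zero    0≢0 → contradiction refl 0≢0
    (suc j) _   → refl
  sum-split {suc n} u (suc i) with sum-split (u ∘ suc) i
  ... | v , eq , v≡u = (λ { zero → u zero ; (suc j) → v j }) , (begin
    u zero + sum (u ∘ suc)           ≡⟨ cong (_+_ (u zero)) eq ⟩
    u zero + (u (suc i) + sum v)     ≡⟨ lemma (u zero) (u (suc i)) (sum v) ⟩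
    u (suc i) + (u zero + sum v)     ∎) , λ where
      zero    _   → refl
      (suc j) i≢j → v≡u j (i≢j ∘ cong suc)
    where
    open ≡-Reasoning
    lemma : ∀ a b c → a + (b + c) ≡ b + (a + c)
    lemma = solve-∀

  three-≤-sum : ∀ {n} (u : Fin n → ℕ) {i j k} → i ≢ j → i ≢ k → j ≢ k → u i + (u j + u k) ≤ sum u
  three-≤-sum u {i} {j} {k} i≢j i≢k j≢k
    with sum-split u i
  ... | v , eqᵤ , v≡u with sum-split v j
  ...   | w , eqᵥ , w≡v with sum-split w k
  ...     | z , eqᵂ , _ rewrite eqᵤ | eqᵥ | eqᵂ | w≡v k j≢k | v≡u j i≢j | v≡u k i≢k =
    +-monoʳ-≤ (u i) (+-monoʳ-≤ (u j) (m≤m+n (u k) (sum z)))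

  infixl 6 _⊕_

  _⊕_ : ∀ {n} → Input n → Input n → Input n
  _⊕_ = zipWith _xor_

  ⊕-flip : ∀ {n} (x y : Input n) i → x ⊕ flip y i ≡ flip (x ⊕ y) i
  ⊕-flip (a ∷ x) (b ∷ y) zero    = cong (_∷ x ⊕ y) (sym (not-distribʳ-xor a b))
  ⊕-flip (a ∷ x) (b ∷ y) (suc i) = cong ((a xor b) ∷_) (⊕-flip x y i)

  ⊕-cancel : ∀ {n} (x y : Input n) → x ⊕ (x ⊕ y) ≡ y
  ⊕-cancel []          []      = refl
  ⊕-cancel (true  ∷ x) (b ∷ y) = cong₂ _∷_ (not-involutive b) (⊕-cancel x y)
  ⊕-cancel (false ∷ x) (b ∷ y) = cong (b ∷_) (⊕-cancel x y)

  -- Only the support of `p` is recorded: relative to an input consistent with `p`, the fixed values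
  -- all become 0.
  face : ∀ {n} → PartialAssignment n → Face n
  face []            = []
  face (just _ ∷ p)  = fixed ∷ face p
  face (nothing ∷ p) = free false ∷ face p

  assignment : ∀ {n} → Input n → Face n → PartialAssignment n
  assignment []      []           = []
  assignment (b ∷ x) (fixed ∷ M)  = just b ∷ assignment x M
  assignment (_ ∷ x) (free _ ∷ M) = nothing ∷ assignment x M

  codimension-face : ∀ {n} (p : PartialAssignment n) → codimension (face p) ≡ codim p
  codimension-face []            = refl
  codimension-face (just _ ∷ p)  = cong suc (codimension-face p)
  codimension-face (nothing ∷ p) = codimension-face p

  codim-assignment : ∀ {n} (x : Input n) M → codim (assignment x M) ≡ codimension M
  codim-assignment []      []           = refl
  codim-assignment (_ ∷ x) (fixed ∷ M)  = cong suc (codim-assignment x M)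
  codim-assignment (_ ∷ x) (free _ ∷ M) = codim-assignment x M

  face-no-true : ∀ {n} (p : PartialAssignment n) i → lookup (face p) i ≢ free true
  face-no-true (just _ ∷ p)  (suc i) = face-no-true p i
  face-no-true (nothing ∷ p) (suc i) = face-no-true p i
  face-no-true (just _ ∷ p)  zero ()
  face-no-true (nothing ∷ p) zero ()

  consistent-face : ∀ {n} (x : Input n) {y} p → Consistent x p → y ∈ face p → Consistent (x ⊕ y) p
  consistent-face (b ∷ x) (just c ∷ p) con (fixed y∈) zero with con zero
  ... | Maybe.just refl = Maybe.just (xor-identityʳ b)
  consistent-face (b ∷ x) (just c ∷ p) con (fixed y∈) (suc i) = consistent-face x p (con ∘ suc) y∈ i
  consistent-face (b ∷ x) (nothing ∷ p) con (free y∈) zero    = Maybe.nothing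
  consistent-face (b ∷ x) (nothing ∷ p) con (free y∈) (suc i) = consistent-face x p (con ∘ suc) y∈ i

  consistent-assignment : ∀ {n} (x : Input n) M → Consistent x (assignment x M)
  consistent-assignment (_ ∷ x) (fixed ∷ M)  zero    = Maybe.just refl
  consistent-assignment (_ ∷ x) (free _ ∷ M) zero    = Maybe.nothing
  consistent-assignment (_ ∷ x) (fixed ∷ M)  (suc i) = consistent-assignment x M i
  consistent-assignment (_ ∷ x) (free _ ∷ M) (suc i) = consistent-assignment x M i

  assignment-∈ : ∀ {n} (x z : Input n) M → Consistent z (assignment x M) → x ⊕ z ∈ M
  assignment-∈ []      []      []           con = []
  assignment-∈ (b ∷ x) (c ∷ z) (fixed ∷ M)  con with con zero
  ... | Maybe.just refl rewrite xor-same b = fixed (assignment-∈ x z M (con ∘ suc))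
  assignment-∈ (b ∷ x) (c ∷ z) (free _ ∷ M) con = free (assignment-∈ x z M (con ∘ suc))

  total-certificate : ∀ {n} (f : BoolFun n) x → CertificateAt f x (Vec.map just x)
  total-certificate f x = (λ i → subst (Maybe.All (lookup x i ≡_)) (sym (lookup-map i just x)) (Maybe.just refl))
                        , λ z con → cong f (unique x z con)
    where
    unique : ∀ {n} (x z : Input n) → Consistent z (Vec.map just x) → z ≡ x
    unique []      []      con = refl
    unique (b ∷ x) (c ∷ z) con with con zero
    ... | Maybe.just refl = cong (c ∷_) (unique x z (con ∘ suc))

  codim-total : ∀ {n} (x : Input n) → codim (Vec.map just x) ≡ n
  codim-total []      = refl
  codim-total (_ ∷ x) = cong suc (codim-total x)

  module _ {n} (f : BoolFun n) (x : Input n) where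

    optimal-certificate : ∃ λ p → CertificateAt f x p × codim p ≡ certificateComplexity f x
    optimal-certificate
      with argmin-sel id n (List.map codim (filter (certificateAt? f x) (partialAssignments n)))
    -- The base value `n` of the minimum is attained by `x` read as a total assignment.
    ... | inj₁ eq = Vec.map just x , total-certificate f x , trans (codim-total x) (sym eq)
    ... | inj₂ k∈ with ∈-map⁻ codim k∈
    ...   | p , p∈ , eq = p , proj₂ (∈-filter⁻ (certificateAt? f x) {xs = partialAssignments n} p∈) , sym eq

    certificateComplexity-≤ : ∀ {p} → CertificateAt f x p → certificateComplexity f x ≤ codim p
    certificateComplexity-≤ {p} cert =
      All.lookup (min≤xs n (List.map codim (filter (certificateAt? f x) (partialAssignments n))))
        (∈-map⁺ codim (∈-filter⁺ (certificateAt? f x) (∈-partialAssignments p) cert))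

  module Translated {n} (f : BoolFun n) (s₁≤2 : s true f ≤ 2) (x : Input n) where

    F : BoolFun n
    F y = f (x ⊕ y)

    F-flip : ∀ y i → F (flip y i) ≡ f (flip (x ⊕ y) i)
    F-flip y i = cong f (⊕-flip x y i)

    F-1-sensitivity : ∀ {y i j k} → i ≢ j → i ≢ k → j ≢ k → F y ≡ true →
      F (flip y i) ≡ false → F (flip y j) ≡ false → F (flip y k) ≡ true
    F-1-sensitivity {y} {i} {j} {k} i≢j i≢k j≢k eq eqᵢ eqⱼ = ¬-not λ eqₖ → contradiction (begin
      3                                ≡⟨ cong₂ _+_ (one eqᵢ) (cong₂ _+_ (one eqⱼ) (one eqₖ)) ⟨
      u i + (u j + u k)                ≤⟨ three-≤-sum u i≢j i≢k j≢k ⟩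
      sum u                            ≡⟨ sensitivity-sum f (x ⊕ y) ⟨
      sensitivity f (x ⊕ y)            ≤⟨ ≤-maxOver true f (sensitivity f) eq ⟩
      s true f                         ≤⟨ s₁≤2 ⟩
      2                                ∎) (<⇒≱ ≤-refl)
      where
      open ≤-Reasoning
      u : Fin n → ℕ
      u i = 𝟙 (f (x ⊕ y) xor f (flip (x ⊕ y) i))
      one : ∀ {i} → F (flip y i) ≡ false → u i ≡ 1
      one {i} eq′ = cong 𝟙 (cong₂ _xor_ eq (trans (sym (F-flip y i)) eq′))

    F-0-sensitivity : ∀ {y} → F y ≡ false → sum (λ i → 𝟙 (F (flip y i))) ≤ s false f
    F-0-sensitivity {y} eq = begin
      sum (λ i → 𝟙 (F (flip y i)))     ≡⟨ sum-cong-≗ (λ i → cong 𝟙 (trans (F-flip y i) (cong (_xor f (flip (x ⊕ y) i)) (sym eq)))) ⟩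
      sum (λ i → 𝟙 (f (x ⊕ y) xor f (flip (x ⊕ y) i))) ≡⟨ sensitivity-sum f (x ⊕ y) ⟨
      sensitivity f (x ⊕ y)            ≤⟨ ≤-maxOver false f (sensitivity f) eq ⟩
      s false f                        ∎
      where open ≤-Reasoning

    open Certificates F (s false f) F-1-sensitivity F-0-sensitivity

    -- Optimality of `p` becomes minimality of its face: a subcube through the origin on which `F`
    -- vanishes translates back to a certificate of `f` at `x` of the same size.
    codim-bound : f x ≡ false → ∀ p → CertificateAt f x p → codim p ≡ certificateComplexity f x →
      Bound (codim p) (s false f)
    codim-bound fx p (con , cert) codim≡ =
      subst (λ m → Bound m (s false f)) (codimension-face p)
        (bound (Minimal.inequalities (face p) vanishes (face-no-true p) minimal))
      where
      vanishes : Vanishes (face p)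
      vanishes y∈M = trans (cert _ (consistent-face x p con y∈M)) fx
      minimal : ∀ N → Vanishes N → codimension (face p) ≤ codimension N
      minimal N vanN = begin
        codimension (face p)          ≡⟨ codimension-face p ⟩
        codim p                       ≡⟨ codim≡ ⟩
        certificateComplexity f x     ≤⟨ certificateComplexity-≤ f x {assignment x N} (consistent-assignment x N , certificate) ⟩
        codim (assignment x N)        ≡⟨ codim-assignment x N ⟩
        codimension N                 ∎
        where
        open ≤-Reasoning
        certificate : Certificate f (f x) (assignment x N)
        certificate z con = trans (cong f (sym (⊕-cancel x z))) (trans (vanN (assignment-∈ x z N con)) (sym fx))

  certificateComplexity-bound : ∀ {n} (f : BoolFun n) → s true f ≤ 2 → ∀ x → f x ≡ false →
    Bound (certificateComplexity f x) (s false f)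
  certificateComplexity-bound f s₁≤2 x fx with optimal-certificate f x
  ... | p , cert , codim≡ =
    subst (λ m → Bound m (s false f)) codim≡ (Translated.codim-bound f s₁≤2 x fx p cert codim≡)

  -- From natural numbers to ℚ(√5)

  ι : ℕ → ℚ
  ι k = ℤ.+ k ℚ./ 1

  toℚᵘ-ι : ∀ k → ℚ.toℚᵘ (ι k) ℚᵘ.≃ mkℚᵘ (ℤ.+ k) 0
  toℚᵘ-ι k = ℚ.toℚᵘ-fromℚᵘ (mkℚᵘ (ℤ.+ k) 0)

  ι-+ : ∀ k l → ι (k + l) ≡ ι k ℚ.+ ι l
  ι-+ k l = ℚ.toℚᵘ-injective (begin
    ℚ.toℚᵘ (ι (k + l))                 ≈⟨ toℚᵘ-ι (k + l) ⟩
    mkℚᵘ (ℤ.+ (k + l)) 0                 ≈⟨ *≡* (cong (ℤ._* ℤ.1ℤ) (trans (ℤ.pos-+ k l) (cong₂ ℤ._+_ (sym (ℤ.*-identityʳ (ℤ.+ k))) (sym (ℤ.*-identityʳ (ℤ.+ l)))))) ⟩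
    mkℚᵘ (ℤ.+ k) 0 ℚᵘ.+ mkℚᵘ (ℤ.+ l) 0     ≈⟨ ℚᵘ.+-cong (toℚᵘ-ι k) (toℚᵘ-ι l) ⟨
    ℚ.toℚᵘ (ι k) ℚᵘ.+ ℚ.toℚᵘ (ι l)     ≈⟨ ℚ.toℚᵘ-homo-+ (ι k) (ι l) ⟨
    ℚ.toℚᵘ (ι k ℚ.+ ι l)               ∎)
    where open ℚᵘ.≃-Reasoning

  ι-* : ∀ k l → ι (k * l) ≡ ι k ℚ.* ι l
  ι-* k l = ℚ.toℚᵘ-injective (begin
    ℚ.toℚᵘ (ι (k * l))                 ≈⟨ toℚᵘ-ι (k * l) ⟩
    mkℚᵘ (ℤ.+ (k * l)) 0                 ≈⟨ *≡* (cong (ℤ._* ℤ.1ℤ) (ℤ.pos-* k l)) ⟩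
    mkℚᵘ (ℤ.+ k) 0 ℚᵘ.* mkℚᵘ (ℤ.+ l) 0     ≈⟨ ℚᵘ.*-cong (toℚᵘ-ι k) (toℚᵘ-ι l) ⟨
    ℚ.toℚᵘ (ι k) ℚᵘ.* ℚ.toℚᵘ (ι l)     ≈⟨ ℚ.toℚᵘ-homo-* (ι k) (ι l) ⟨
    ℚ.toℚᵘ (ι k ℚ.* ι l)               ∎)
    where open ℚᵘ.≃-Reasoning

  0≤ι : ∀ k → 0ℚ ℚ.≤ ι k
  0≤ι k = ℚ.nonNegative⁻¹ (ι k) ⦃ ℚ.normalize-nonNeg k 1 ⦄

  ι-mono-≤ : ∀ {k l} → k ≤ l → ι k ℚ.≤ ι l
  ι-mono-≤ {k} k≤l with m≤n⇒∃[o]m+o≡n k≤l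
  ... | o , refl = begin
    ι k             ≡⟨ ℚ.+-identityʳ (ι k) ⟨
    ι k ℚ.+ 0ℚ      ≤⟨ ℚ.+-monoʳ-≤ (ι k) (0≤ι o) ⟩
    ι k ℚ.+ ι o     ≡⟨ ι-+ k o ⟨
    ι (k + o)       ∎
    where open ℚ.≤-Reasoning

  1/22 : ℚ
  1/22 = ℤ.+ 1 ℚ./ 22

  -- The difference of the two sides is (37 s - 22 m) / 22 + (s / 22) √5. Its rational part is
  -- nonnegative in the first case of `Bound`; in the second it is -e / 22, and squares are
  -- compared.
  Bound⇒≤ : ∀ m s → Bound m s → fromℕ m Defs.≤ (fromℕ 37 Defs.+ √5) Defs./ 22 Defs.* fromℕ s
  Bound⇒≤ m s b = subst₂ (λ q r → NonNegative (q +√5· r)) (sym rat≡) (sym irr≡) (nonNeg b)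
    where
    open +-*-Solver using (solve; _:+_; _:*_; _:-_; _:=_; con)
    rat≡ : (ℤ.+ 37 ℚ./ 22) ℚ.* ι s ℚ.+ ι 5 ℚ.* (1/22 ℚ.* 0ℚ) ℚ.- ι m ≡ 1/22 ℚ.* (ι (37 * s) ℚ.- ι (22 * m))
    rat≡ = trans (solve 2 (λ m s → con (ℤ.+ 37 ℚ./ 22) :* s :+ con (ι 5) :* (con 1/22 :* con 0ℚ) :- m
                    := con 1/22 :* (con (ι 37) :* s :- con (ι 22) :* m)) refl (ι m) (ι s))
                 (cong (1/22 ℚ.*_) (cong₂ ℚ._-_ (sym (ι-* 37 s)) (sym (ι-* 22 m))))
    irr≡ : (ℤ.+ 37 ℚ./ 22) ℚ.* 0ℚ ℚ.+ 1/22 ℚ.* ι s ℚ.- 0ℚ ≡ 1/22 ℚ.* ι s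
    irr≡ = solve 1 (λ s → con (ℤ.+ 37 ℚ./ 22) :* con 0ℚ :+ con 1/22 :* s :- con 0ℚ := con 1/22 :* s) refl (ι s)
    0≤1/22* : ∀ k → 0ℚ ℚ.≤ 1/22 ℚ.* ι k
    0≤1/22* k = ℚ.*-monoˡ-≤-nonNeg 1/22 (0≤ι k)
    nonNeg : Bound m s → NonNegative (1/22 ℚ.* (ι (37 * s) ℚ.- ι (22 * m)) +√5· 1/22 ℚ.* ι s)
    nonNeg (inj₁ le) with m≤n⇒∃[o]m+o≡n le
    ... | e , eq = both (subst (λ q → 0ℚ ℚ.≤ 1/22 ℚ.* q) (begin
        ι e                                        ≡⟨ solve 2 (λ m e → e := m :+ e :- m) refl (ι (22 * m)) (ι e) ⟩
        ι (22 * m) ℚ.+ ι e ℚ.- ι (22 * m)          ≡⟨ cong (ℚ._- ι (22 * m)) (ι-+ (22 * m) e) ⟨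
        ι (22 * m + e) ℚ.- ι (22 * m)              ≡⟨ cong (λ k → ι k ℚ.- ι (22 * m)) eq ⟩
        ι (37 * s) ℚ.- ι (22 * m)                  ∎) (0≤1/22* e)) (0≤1/22* s)
      where open ≡-Reasoning
    nonNeg (inj₂ (e , eq , le)) = irr≥ (0≤1/22* s) (begin
        1/22 ℚ.* d ℚ.* (1/22 ℚ.* d)                ≡⟨ cong (λ q → 1/22 ℚ.* q ℚ.* (1/22 ℚ.* q)) d≡ ⟩
        1/22 ℚ.* (ℚ.- ι e) ℚ.* (1/22 ℚ.* (ℚ.- ι e)) ≡⟨ solve 1 (λ e → con 1/22 :* (:- e) :* (con 1/22 :* (:- e)) := con 1/484 :* (e :* e)) refl (ι e) ⟩
        1/484 ℚ.* (ι e ℚ.* ι e)                    ≡⟨ cong (1/484 ℚ.*_) (ι-* e e) ⟨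
        1/484 ℚ.* ι (e * e)                        ≤⟨ ℚ.*-monoˡ-≤-nonNeg 1/484 (ι-mono-≤ le) ⟩
        1/484 ℚ.* ι (5 * (s * s))                  ≡⟨ cong (1/484 ℚ.*_) (trans (ι-* 5 (s * s)) (cong (ι 5 ℚ.*_) (ι-* s s))) ⟩
        1/484 ℚ.* (ι 5 ℚ.* (ι s ℚ.* ι s))          ≡⟨ solve 1 (λ s → con 1/484 :* (con (ι 5) :* (s :* s)) := con (ι 5) :* (con 1/22 :* s :* (con 1/22 :* s))) refl (ι s) ⟩
        ι 5 ℚ.* (1/22 ℚ.* ι s ℚ.* (1/22 ℚ.* ι s))  ∎)
      where
      open ℚ.≤-Reasoning
      open +-*-Solver using (:-_)
      1/484 = ℤ.+ 1 ℚ./ 484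
      d = ι (37 * s) ℚ.- ι (22 * m)
      d≡ : d ≡ ℚ.- ι e
      d≡ = begin-equality
        ι (37 * s) ℚ.- ι (22 * m)                  ≡⟨ cong (λ k → ι (37 * s) ℚ.- ι k) eq ⟩
        ι (37 * s) ℚ.- ι (37 * s + e)              ≡⟨ cong (λ q → ι (37 * s) ℚ.- q) (ι-+ (37 * s) e) ⟩
        ι (37 * s) ℚ.- (ι (37 * s) ℚ.+ ι e)        ≡⟨ solve 2 (λ s e → s :- (s :+ e) := :- e) refl (ι (37 * s)) (ι e) ⟩
        ℚ.- ι e                                    ∎

open import Defs
open import Data.Bool.Base using (true; false)
open import Data.Nat.Base using (ℕ; z≤n)
open import Data.Nat.Properties using (≤-reflexive)
open import Data.Sum.Base using (inj₁)
open import Relation.Binary.PropositionalEquality using (_≡_)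
open Development using (Bound; Bound⇒≤; maxOver-all; certificateComplexity-bound)

theorem2 : ∀ (n : ℕ) (f : BoolFun n) → s true f ≡ 2 →
    fromℕ (C false f) ≤ (fromℕ 37 + √5) / 22 * fromℕ (s false f)
theorem2 n f eq = Bound⇒≤ (C false f) (s false f)
  -- `inj₁ z≤n` handles the default value 0.
  (maxOver-all false f (certificateComplexity f) (λ m → Bound m (s false f)) (inj₁ z≤n)
    (certificateComplexity-bound f (≤-reflexive eq)))
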